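{- Let $A$ be a punctual injection structure which is relatively $\Delta^0_1$-categorical, has at least one infinite orbit, and has infinitely many finite orbits. Then $\mathrm{PRCatSpec}(A)=\mathrm{Cone}(\Delta^0_1)$.
   Context: A punctual structure is a structure with domain $\omega$ whose operations and relations are uniformly primitive recursive. An injection structure is a structure $(D,f)$ in the language of one unary function symbol, with $f:D\to D$ injective. The orbit of $a\in D$ is $\{b\in D : f^n(a)=b \text{ or } f^n(b)=a \text{ for some } n\in\omega\}$. Each orbit is either finite (a cycle), or an $\omega$-chain (infinite with a first element not in the range of $f$), or a $\zeta$-chain (infinite, with every element in the range of $f$). A computable structure $A$ is relatively $\Delta^0_\alpha$-categorical if for every structure $B\cong A$ with domain $\omega$ (not necessarily computable) there is an isomorphism from $A$ to $B$ which is $\Delta^0_\alpha$ relative to the atomic diagram of $B$. For total functions $f,g:\omega\to\omega$, write $f\leq_{PR} g$ if there is a primitive recursive scheme $\Psi$ (a primitive recursive definition which may additionally use the oracle function as a basic function) with $\Psi^{g}=f$. Write $f\equiv_{PR}g$ if $f\leq_{PR}g$ and $g\leq_{PR}f$. The $\equiv_{PR}$-classes are the PR-degrees, ordered by $\leq_{PR}$. For a punctual structure $A$, $\mathrm{PRCatSpec}(A)$ is the set of all PR-degrees $\mathbf d$ such that for every punctual structure $B\cong A$ there is an isomorphism $f:A\to B$ with $f\leq_{PR}\mathbf d$ and $f^{ -1}\leq_{PR}\mathbf d$. For a computable ordinal $\alpha>0$, $\mathrm{Cone}(\Delta^0_\alpha)$ is the set of all PR-degrees $\mathbf d$ such that $f\leq_{PR}\mathbf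 d$ for every total $\Delta^0_\alpha$ function $f:\omega\to\omega$. -}

module Defs where

open import Data.Bool.Base using (Bool; if_then_else_)
open import Data.Fin.Base using (Fin)
open import Data.List.Relation.Unary.Any using (Any)
open import Data.Nat.Base using (ℕ; zero; suc; _<_; _≡ᵇ_)
open import Data.Nat.GeneralisedArithmetic using (fold)
open import Data.Product.Base using (∃-syntax; Σ-syntax; _×_; _,_)
open import Data.Sum.Base using (_⊎_)
open import Data.Vec.Base using (Vec; []; _∷_; lookup)
open import Function.Bundles using (_↔_; _⇔_; Inverse)
open import Level using (0ℓ)
open import Relation.Binary.Core using (Rel)
open import Relation.Binary.Definitions using (_Respects_)
open import Relation.Binary.PropositionalEquality using (_≡_; refl; trans; cong; cong₂)
open import Relation.Nullary using (¬_)
open import Relation.Unary using (Pred)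

------------------------------------------------------------------------
-- Oracles

-- O n is the set of names of the n-ary oracle functions.
Signature : Set₁
Signature = ℕ → Set

Oracle : Signature → Set
Oracle O = ∀ {n} → O n → Vec ℕ n → ℕ

data None : Signature where

none : Oracle None
none ()

data Single (k : ℕ) : Signature where
  the : Single k k

single : {k : ℕ} → (Vec ℕ k → ℕ) → Oracle (Single k)
single g the = g

-- A unary function, regarded as a function of vectors of length one.
unary : (ℕ → ℕ) → Vec ℕ 1 → ℕ
unary g (x ∷ []) = g x

------------------------------------------------------------------------
-- Primitive recursive schemes and PR-reducibility

data PR (O : Signature) : ℕ → Set where
  zero : PR O 0
  suc  : PR O 1
  proj : {n : ℕ} → Fin n → PR O n
  ask  : {n : ℕ} → O n → PR O n
  comp : {m n : ℕ} → PR O m → Vec (PR O n) m → PR O n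
  rec  : {n : ℕ} → PR O n → PR O (suc (suc n)) → PR O (suc n)

module _ {O : Signature} (I : Oracle O) where

  -- In rec p q the recursion is on the first argument; q receives the
  -- predecessor, then the previous value, then the parameters.
  mutual
    eval : {n : ℕ} → PR O n → Vec ℕ n → ℕ
    eval zero        xs             = 0
    eval suc         (x ∷ [])       = suc x
    eval (proj i)    xs             = lookup xs i
    eval (ask o)     xs             = I o xs
    eval (comp p qs) xs             = eval p (evals qs xs)
    eval (rec p q)   (zero  ∷ xs)   = eval p xs
    eval (rec p q)   (suc x ∷ xs)   = eval q (x ∷ eval (rec p q) (x ∷ xs) ∷ xs)

    evals : {m n : ℕ} → Vec (PR O n) m → Vec ℕ n → Vec ℕ m
    evals []       xs = []
    evals (p ∷ ps) xs = eval p xs ∷ evals ps xs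

PrimitiveRecursive : Pred (ℕ → ℕ) 0ℓ
PrimitiveRecursive f = ∃[ p ] ∀ x → eval none p (x ∷ []) ≡ f x

infix 4 _≤PR_ _≡PR_

_≤PR_ : Rel (ℕ → ℕ) 0ℓ
f ≤PR g = ∃[ p ] ∀ x → eval (single (unary g)) p (x ∷ []) ≡ f x

_≡PR_ : Rel (ℕ → ℕ) 0ℓ
f ≡PR g = f ≤PR g × g ≤PR f

------------------------------------------------------------------------
-- Relative computability (μ-recursive functions with an oracle)

data Rec (O : Signature) : ℕ → Set where
  zero : Rec O 0
  suc  : Rec O 1
  proj : {n : ℕ} → Fin n → Rec O n
  ask  : {n : ℕ} → O n → Rec O n
  comp : {m n : ℕ} → Rec O m → Vec (Rec O n) m → Rec O n
  rec  : {n : ℕ} → Rec O n → Rec O (suc (suc n)) → Rec O (suc n)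
  min  : {n : ℕ} → Rec O (suc n) → Rec O n

module _ {O : Signature} (I : Oracle O) where

  infix 4 _·_⇓_ _·_⇓*_

  -- e · xs ⇓ y : the partial function coded by e converges on xs with
  -- value y.
  mutual
    data _·_⇓_ : {n : ℕ} → Rec O n → Vec ℕ n → ℕ → Set where
      zero⇓ : zero · [] ⇓ 0
      suc⇓  : ∀ {x} → suc · x ∷ [] ⇓ suc x
      proj⇓ : ∀ {n} {i : Fin n} {xs} → proj i · xs ⇓ lookup xs i
      ask⇓  : ∀ {n} {o : O n} {xs} → ask o · xs ⇓ I o xs
      comp⇓ : ∀ {m n} {e : Rec O m} {ds : Vec (Rec O n) m} {xs ys z} →
              ds · xs ⇓* ys → e · ys ⇓ z → comp e ds · xs ⇓ z
      rec⇓₀ : ∀ {n} {d : Rec O n} {e : Rec O (suc (suc n))} {xs y} →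
              d · xs ⇓ y → rec d e · zero ∷ xs ⇓ y
      rec⇓₊ : ∀ {n} {d : Rec O n} {e : Rec O (suc (suc n))} {x xs y z} →
              rec d e · x ∷ xs ⇓ y → e · x ∷ y ∷ xs ⇓ z →
              rec d e · suc x ∷ xs ⇓ z
      min⇓  : ∀ {n} {e : Rec O (suc n)} {xs y} →
              (∀ z → z < y → ∃[ v ] e · z ∷ xs ⇓ suc v) →
              e · y ∷ xs ⇓ 0 → min e · xs ⇓ y

    data _·_⇓*_ : {m n : ℕ} → Vec (Rec O n) m → Vec ℕ n → Vec ℕ m → Set where
      []  : ∀ {n} {xs : Vec ℕ n} → [] · xs ⇓* []
      _∷_ : ∀ {m n} {e : Rec O n} {es : Vec (Rec O n) m} {xs y ys} →
            e · xs ⇓ y → es · xs ⇓* ys → e ∷ es · xs ⇓* y ∷ ys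

  Computable : {n : ℕ} → Pred (Vec ℕ n → ℕ) 0ℓ
  Computable f = ∃[ e ] ∀ xs → e · xs ⇓ f xs

-- The characteristic function; 1 means "true".
χ : {n : ℕ} → (Vec ℕ n → Bool) → Vec ℕ n → ℕ
χ R xs = if R xs then 1 else 0

------------------------------------------------------------------------
-- Σ⁰₁ and Δ⁰₁ relative to an oracle

Graph : (ℕ → ℕ) → Pred (Vec ℕ 2) 0ℓ
Graph f (x ∷ y ∷ []) = f x ≡ y

module _ {O : Signature} (I : Oracle O) where

  Σ⁰₁ : {n : ℕ} → Pred (Pred (Vec ℕ n) 0ℓ) 0ℓ
  Σ⁰₁ {n} P = ∃[ R ] Computable I (χ {suc n} R) ×
                     (∀ xs → P xs ⇔ (∃[ z ] χ R (z ∷ xs) ≡ 1))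

  Δ⁰₁ : {n : ℕ} → Pred (Pred (Vec ℕ n) 0ℓ) 0ℓ
  Δ⁰₁ P = Σ⁰₁ P × Σ⁰₁ (λ xs → ¬ P xs)

  Δ⁰₁Function : Pred (ℕ → ℕ) 0ℓ
  Δ⁰₁Function f = Δ⁰₁ (Graph f)

------------------------------------------------------------------------
-- Structures (ω , f) with one unary function

infix 4 _≅_

record _≅_ (f g : ℕ → ℕ) : Set where
  field
    bijection : ℕ ↔ ℕ
  open Inverse bijection public using (to; from)
  field
    commutes : ∀ x → to (f x) ≡ g (to x)

open _≅_ public using (to; from)

-- The atomic sentences over (ω , f), with a constant for each element,
-- are the equations fⁿ(a) = fᵐ(b); the diagram lists their truth values.
atomicTruth : (ℕ → ℕ) → Vec ℕ 4 → Bool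
atomicTruth f (n ∷ a ∷ m ∷ b ∷ []) = fold a f n ≡ᵇ fold b f m

atomicDiagram : (ℕ → ℕ) → Vec ℕ 4 → ℕ
atomicDiagram f = χ (atomicTruth f)

RelativelyΔ⁰₁Categorical : Pred (ℕ → ℕ) 0ℓ
RelativelyΔ⁰₁Categorical f =
  ∀ g → f ≅ g → Σ[ θ ∈ f ≅ g ] Δ⁰₁Function (single (atomicDiagram g)) (to θ)

Orbit : (ℕ → ℕ) → ℕ → Pred ℕ 0ℓ
Orbit f a b = ∃[ n ] (fold a f n ≡ b ⊎ fold b f n ≡ a)

FiniteUpTo : Rel ℕ 0ℓ → Pred ℕ 0ℓ → Set
FiniteUpTo _∼_ P = ∃[ xs ] ∀ a → P a → Any (λ x → x ∼ a) xs

FiniteOrbit : (ℕ → ℕ) → Pred ℕ 0ℓ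
FiniteOrbit f a = FiniteUpTo _≡_ (Orbit f a)

HasInfiniteOrbit : Pred (ℕ → ℕ) 0ℓ
HasInfiniteOrbit f = ∃[ a ] ¬ FiniteOrbit f a

-- Orbits are counted through their elements: two elements represent the
-- same orbit when one lies in the orbit of the other.
InfinitelyManyFiniteOrbits : Pred (ℕ → ℕ) 0ℓ
InfinitelyManyFiniteOrbits f = ¬ FiniteUpTo (Orbit f) (FiniteOrbit f)

------------------------------------------------------------------------
-- Sets of PR-degrees, given by ≡PR-invariant predicates on representatives

PRCatSpec : (ℕ → ℕ) → Pred (ℕ → ℕ) 0ℓ
PRCatSpec f d = ∀ g → PrimitiveRecursive g → f ≅ g →
  Σ[ θ ∈ f ≅ g ] (to θ ≤PR d × from θ ≤PR d)

ConeΔ⁰₁ : Pred (ℕ → ℕ) 0ℓ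
ConeΔ⁰₁ d = ∀ f → Δ⁰₁Function none f → f ≤PR d

module _ (q : PR (Single 1) 1) where

  mutual
    substitute : {n : ℕ} → PR (Single 1) n → PR (Single 1) n
    substitute zero        = zero
    substitute suc         = suc
    substitute (proj i)    = proj i
    substitute (ask the)   = q
    substitute (comp p ps) = comp (substitute p) (substitutes ps)
    substitute (rec p p′)  = rec (substitute p) (substitute p′)

    substitutes : {m n : ℕ} → Vec (PR (Single 1) n) m → Vec (PR (Single 1) n) m
    substitutes []       = []
    substitutes (p ∷ ps) = substitute p ∷ substitutes ps

module _ {d e : ℕ → ℕ} (q : PR (Single 1) 1)
         (q-computes : ∀ x → eval (single (unary e)) q (x ∷ []) ≡ d x) where

  mutual
    eval-substitute : {n : ℕ} (p : PR (Single 1) n) (xs : Vec ℕ n) →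
      eval (single (unary e)) (substitute q p) xs ≡ eval (single (unary d)) p xs
    eval-substitute zero        xs       = refl
    eval-substitute suc         (x ∷ []) = refl
    eval-substitute (proj i)    xs       = refl
    eval-substitute (ask the)   (x ∷ []) = q-computes x
    eval-substitute (comp p ps) xs       =
      trans (eval-substitute p _) (cong (eval _ p) (evals-substitutes ps xs))
    eval-substitute (rec p p′)  (zero ∷ xs)  = eval-substitute p xs
    eval-substitute (rec p p′)  (suc x ∷ xs) =
      trans (eval-substitute p′ _)
            (cong (λ y → eval _ p′ (x ∷ y ∷ xs)) (eval-substitute (rec p p′) (x ∷ xs)))

    evals-substitutes : {m n : ℕ} (ps : Vec (PR (Single 1) n) m) (xs : Vec ℕ n) →
      evals (single (unary e)) (substitutes q ps) xs ≡ evals (single (unary d)) ps xs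
    evals-substitutes []       xs = refl
    evals-substitutes (p ∷ ps) xs =
      cong₂ _∷_ (eval-substitute p xs) (evals-substitutes ps xs)

≤PR-trans : {f d e : ℕ → ℕ} → f ≤PR d → d ≤PR e → f ≤PR e
≤PR-trans (p , p-computes) (q , q-computes) =
  substitute q p ,
  λ x → trans (eval-substitute q q-computes p _) (p-computes x)

PRCatSpec-respects : (f : ℕ → ℕ) → PRCatSpec f Respects _≡PR_
PRCatSpec-respects f (d≤e , _) d∈ g pr f≅g with d∈ g pr f≅g
... | θ , to≤d , from≤d = θ , ≤PR-trans to≤d d≤e , ≤PR-trans from≤d d≤e

ConeΔ⁰₁-respects : ConeΔ⁰₁ Respects _≡PR_
ConeΔ⁰₁-respects (d≤e , _) d∈ f f∈Δ = ≤PR-trans (d∈ f f∈Δ) d≤e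

{-# OPTIONS --safe #-}

-- Cone ⊆ PRCatSpec: the atomic diagram of a punctual copy of f is computable,
-- so the isomorphism given by relative categoricity is Δ⁰₁, and so is its
-- inverse, whose graph is the transposed one.
--
-- PRCatSpec ⊆ Cone: given a computable h, take two punctual copies of f, in
-- both of which the infinite orbits are laid out explicitly (this only takes
-- the numbers of ω-chains and ζ-chains) and one infinite orbit, the main
-- chain, absorbs every code that turns out to be superfluous.  In the fast
-- copy the codes are absorbed one at a time, so that the number of steps from
-- a fixed element to x is at most linear in x.  In the slow copy the n-th
-- column of fresh elements is extended for as long as no computation of h n
-- has been found, and only then inserted into the main chain, at a position
-- beyond the length of the search.  An isomorphism from the slow to the fast
-- copy sends the head of the column to an element that bounds this position,
-- and hence the search for h n.

module Submission where

open import Defs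
open import Axiom.ExcludedMiddle using (ExcludedMiddle)
open import Data.Bool.Base using (Bool; true; false; not; _∧_; _∨_; if_then_else_)
open import Data.Bool.Properties using (T-≡; ¬-not; if-float)
open import Data.Fin.Base using (Fin; zero; suc)
open import Data.List.Base using (applyUpTo)
open import Data.List.Relation.Unary.Any using (Any)
open import Data.List.Relation.Unary.Any.Properties using (applyUpTo⁺)
open import Data.Nat.Base
open import Data.Nat.GeneralisedArithmetic using (fold; fold-+)
open import Data.Nat.Properties
open import Algebra.Properties.CommutativeSemigroup +-commutativeSemigroup using (x∙yz≈y∙xz)
open import Data.Nat.Solver using (module +-*-Solver)
open import Data.Product.Base using (∃; ∃-syntax; Σ-syntax; _×_; _,_; proj₁; proj₂; swap)
open import Data.Sum.Base as Sum using (_⊎_; inj₁; inj₂)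
open import Data.Vec.Base using (Vec; []; _∷_; head; tail; lookup; tabulate)
open import Data.Vec.Properties using (tabulate∘lookup)
open import Function.Base using (_∘_)
open import Function.Bundles using (_↔_; _⇔_; mk↔ₛ′; mk⇔; Inverse; Equivalence)
open import Function.Construct.Composition using (_↔-∘_; _⇔-∘_)
open import Function.Definitions using (Injective)
open import Level using (0ℓ)
open import Relation.Binary.Definitions using (tri<; tri≈; tri>)
open import Relation.Binary.PropositionalEquality
open import Relation.Nullary using (¬_; contradiction; Dec; yes; no)
open import Relation.Nullary.Decidable using (decidable-stable)
open import Relation.Unary using (Pred; _≐_; _⊆_)

-- Primitive recursive functions

-- A primitive recursive copy cannot ask which elements of `f` lie on finite orbits, but it can
-- check whether `y` has minimal period `k + 1`. An element of an infinite orbit fails it for every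
-- `k`, which is why these orbits are built afresh. Only the copies have to be effective: the
-- isomorphism between `f` and a copy comes from excluded middle, by matching one representative per
-- orbit. That a column is inserted beyond the length of its search needs no bookkeeping: its last
-- element `col u v` has a code at least `v`, and `main m` is at least `m` steps away from `main 0`.
-- The isomorphism from the slow to the fast copy may move `main 0` to any place on any infinite
-- orbit. The potential on the fast copy is therefore defined on all of these orbits, backward
-- halves included, and the image of `main 0` contributes only an additive constant.

bit : Bool → ℕ
bit b = if b then 1 else 0

x₀ : ∀ {n} → Vec ℕ (suc n) → ℕ
x₀ = head

x₁ : ∀ {n} → Vec ℕ (2 + n) → ℕ
x₁ = x₀ ∘ tail

x₂ : ∀ {n} → Vec ℕ (3 + n) → ℕ
x₂ = x₁ ∘ tail

any< : (ℕ → Bool) → ℕ → Bool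
any< p zero    = false
any< p (suc k) = p k ∨ any< p k

any<-intro : ∀ p {k i} → i < k → p i ≡ true → any< p k ≡ true
any<-intro p {suc k} {i} i<1+k pi with m≤n⇒m<n∨m≡n (s≤s⁻¹ i<1+k)
... | inj₂ refl = cong (_∨ any< p k) pi
... | inj₁ i<k with p k
...   | true  = refl
...   | false = any<-intro p i<k pi

any<-elim : ∀ p k → any< p k ≡ true → ∃[ i ] i < k × p i ≡ true
any<-elim p (suc k) eq with p k in pk
... | true  = k , ≤-refl , pk
... | false = let i , i<k , pi = any<-elim p k eq in i , m<n⇒m<1+n i<k , pi

-- Cantor's pairing function

triangle : ℕ → ℕ
triangle zero    = 0
triangle (suc n) = suc n + triangle n

-- The inverse of `triangle`, rounded down. The recursion on `x` replaces a search, so that it is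
-- primitive recursive as it stands.
diagonal : ℕ → ℕ
diagonal zero    = 0
diagonal (suc x) = if suc x <ᵇ triangle (suc (diagonal x)) then diagonal x else suc (diagonal x)

diagonal-bounds : ∀ x → triangle (diagonal x) ≤ x × x < triangle (suc (diagonal x))
diagonal-bounds zero    = z≤n , s≤s z≤n
diagonal-bounds (suc x) with suc x <ᵇ triangle (suc (diagonal x)) in eq | diagonal-bounds x
... | true  | lo , _ = m≤n⇒m≤1+n lo , <ᵇ⇒< (suc x) _ (Equivalence.from T-≡ eq)
... | false | _ , hi =
  ≮⇒≥ (λ lt → contradiction (trans (sym eq) (Equivalence.to T-≡ (<⇒<ᵇ lt))) λ ()) ,
  ≤-trans (s≤s hi) (+-monoˡ-≤ (triangle (suc (diagonal x))) (s≤s (z≤n {suc (diagonal x)})))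

triangle-mono : ∀ {m n} → m ≤ n → triangle m ≤ triangle n
triangle-mono z≤n     = z≤n
triangle-mono (s≤s p) = +-mono-≤ (s≤s p) (triangle-mono p)

diagonal-unique : ∀ {w x} → triangle w ≤ x → x < triangle (suc w) → diagonal x ≡ w
diagonal-unique {w} {x} lo hi = let lo′ , hi′ = diagonal-bounds x in
  ≤-antisym (≮⇒≥ λ w<r → <-irrefl refl (<-≤-trans hi (≤-trans (triangle-mono w<r) lo′)))
            (≮⇒≥ λ r<w → <-irrefl refl (<-≤-trans hi′ (≤-trans (triangle-mono r<w) lo)))

n≤triangle : ∀ n → n ≤ triangle n
n≤triangle zero    = z≤n
n≤triangle (suc n) = m≤m+n (suc n) _

opaque

  pair : ℕ → ℕ → ℕ
  pair u v = u + triangle (u + v)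

  left : ℕ → ℕ
  left x = x ∸ triangle (diagonal x)

  right : ℕ → ℕ
  right x = diagonal x ∸ left x

  diagonal-pair : ∀ u v → diagonal (pair u v) ≡ u + v
  diagonal-pair u v = diagonal-unique {u + v} (m≤n+m _ u)
    (s≤s (+-monoˡ-≤ (triangle (u + v)) (m≤m+n u v)))

  left-pair : ∀ u v → left (pair u v) ≡ u
  left-pair u v rewrite diagonal-pair u v = m+n∸n≡m u (triangle (u + v))

  right-pair : ∀ u v → right (pair u v) ≡ v
  right-pair u v rewrite left-pair u v | diagonal-pair u v = m+n∸m≡n u v

  pair-left-right : ∀ x → pair (left x) (right x) ≡ x
  pair-left-right x = let lo , hi = diagonal-bounds x in begin
    left x + triangle (left x + right x)  ≡⟨ cong (λ w → left x + triangle w) (m+[n∸m]≡n left≤diagonal) ⟩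
    left x + triangle (diagonal x)            ≡⟨ m∸n+n≡m lo ⟩
    x                                     ∎
    where
    open ≡-Reasoning
    left≤diagonal : left x ≤ diagonal x
    left≤diagonal = let lo , hi = diagonal-bounds x in
      ≤-trans (∸-monoˡ-≤ (triangle (diagonal x)) (s≤s⁻¹ hi))
              (≤-reflexive (m+n∸n≡m (diagonal x) (triangle (diagonal x))))

  -- The size estimate for codes: the position of an element in its column or on the main chain is
  -- bounded by its code.
  right≤pair : ∀ u v → v ≤ pair u v
  right≤pair u v = ≤-trans (m≤n+m v u) (≤-trans (n≤triangle (u + v)) (m≤n+m _ u))

-- Closure properties of the functions primitive recursive in an oracle

module Closure {O : Signature} (I : Oracle O) where

  Prim : {n : ℕ} → (Vec ℕ n → ℕ) → Set
  Prim F = ∃[ p ] ∀ xs → eval I p xs ≡ F xs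

  -- A record rather than an abbreviation, so that the type determines `f`.
  record Prim₁ (f : ℕ → ℕ) : Set where
    constructor prim₁
    field prim : Prim {1} λ xs → f (x₀ xs)

  record Prim₂ (f : ℕ → ℕ → ℕ) : Set where
    constructor prim₂
    field prim : Prim {2} λ xs → f (x₀ xs) (x₁ xs)

  record Prim₃ (f : ℕ → ℕ → ℕ → ℕ) : Set where
    constructor prim₃
    field prim : Prim {3} λ xs → f (x₀ xs) (x₁ xs) (x₂ xs)

  Prim-≗ : ∀ {n} {F G : Vec ℕ n → ℕ} → F ≗ G → Prim F → Prim G
  Prim-≗ F≗G (p , p≗F) = p , λ xs → trans (p≗F xs) (F≗G xs)

  Prim-unary : ∀ {f} → (∃[ p ] ∀ x → eval I p (x ∷ []) ≡ f x) → Prim₁ f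
  Prim-unary (p , p≗f) = prim₁ (p , λ { (x ∷ []) → p≗f x })

  unary-Prim : ∀ {f} → Prim₁ f → ∃[ p ] ∀ x → eval I p (x ∷ []) ≡ f x
  unary-Prim (prim₁ (p , p≗f)) = p , λ x → p≗f (x ∷ [])

  const-Prim : ∀ {n} k → Prim {n} λ _ → k
  const-Prim zero    = comp zero [] , λ _ → refl
  const-Prim (suc k) = let p , p≗ = const-Prim k in
    comp suc (p ∷ []) , λ xs → cong suc (p≗ xs)

  v₀ : ∀ {n} → Prim (x₀ {n})
  v₀ = proj zero , λ { (x ∷ _) → refl }

  v₁ : ∀ {n} → Prim (x₁ {n})
  v₁ = proj (suc zero) , λ { (_ ∷ x ∷ _) → refl }

  v₂ : ∀ {n} → Prim (x₂ {n})
  v₂ = proj (suc (suc zero)) , λ { (_ ∷ _ ∷ x ∷ _) → refl }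

  compose₁ : ∀ {n} {f} {A : Vec ℕ n → ℕ} →
    Prim₁ f → Prim A → Prim λ xs → f (A xs)
  compose₁ {f = f} (prim₁ (p , p≗)) (a , a≗) =
    comp p (a ∷ []) , λ xs → trans (p≗ _) (cong f (a≗ xs))

  compose₂ : ∀ {n} {f} {A B : Vec ℕ n → ℕ} →
    Prim₂ f → Prim A → Prim B → Prim λ xs → f (A xs) (B xs)
  compose₂ {f = f} (prim₂ (p , p≗)) (a , a≗) (b , b≗) =
    comp p (a ∷ b ∷ []) , λ xs → trans (p≗ _) (cong₂ f (a≗ xs) (b≗ xs))

  compose₃ : ∀ {n} {f} {A B C : Vec ℕ n → ℕ} →
    Prim₃ f → Prim A → Prim B → Prim C → Prim λ xs → f (A xs) (B xs) (C xs)
  compose₃ {f = f} {A} {B} (prim₃ (p , p≗)) (a , a≗) (b , b≗) (c , c≗) =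
    comp p (a ∷ b ∷ c ∷ []) , λ xs → trans (p≗ _)
      (trans (cong₂ (λ x y → f x y _) (a≗ xs) (b≗ xs)) (cong (f (A xs) (B xs)) (c≗ xs)))

  Prim-rec : ∀ {n} {F : Vec ℕ (suc n) → ℕ} {S : Vec ℕ (2 + n) → ℕ} →
    Prim (λ xs → F (0 ∷ xs)) → Prim S →
    (∀ k xs → F (suc k ∷ xs) ≡ S (k ∷ F (k ∷ xs) ∷ xs)) → Prim F
  Prim-rec {F = F} {S} (z , z≗) (s , s≗) step = rec z s , correct
    where
    correct : ∀ xs → eval I (rec z s) xs ≡ F xs
    correct (zero  ∷ xs) = z≗ xs
    correct (suc k ∷ xs) = trans (s≗ _)
      (trans (cong (λ y → S (k ∷ y ∷ xs)) (correct (k ∷ xs))) (sym (step k xs)))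

  PrimVec : {m n : ℕ} → (Vec ℕ n → Vec ℕ m) → Set
  PrimVec σ = ∃[ ps ] ∀ xs → evals I ps xs ≡ σ xs

  []-Prim : ∀ {n} → PrimVec {n = n} λ _ → []
  []-Prim = [] , λ _ → refl

  infixr 5 _∷-Prim_
  _∷-Prim_ : ∀ {m n} {A : Vec ℕ n → ℕ} {σ : Vec ℕ n → Vec ℕ m} →
    Prim A → PrimVec σ → PrimVec λ xs → A xs ∷ σ xs
  (a , a≗) ∷-Prim (ps , ps≗) = a ∷ ps , λ xs → cong₂ _∷_ (a≗ xs) (ps≗ xs)

  projections-Prim : ∀ {m n} (g : Fin m → Fin n) → PrimVec λ xs → tabulate λ i → lookup xs (g i)
  projections-Prim {zero}  g = []-Prim
  projections-Prim {suc m} g = (proj (g zero) , λ _ → refl) ∷-Prim projections-Prim (λ i → g (suc i))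

  PrimVec-≗ : ∀ {m n} {σ τ : Vec ℕ n → Vec ℕ m} → σ ≗ τ → PrimVec σ → PrimVec τ
  PrimVec-≗ σ≗τ (ps , ps≗) = ps , λ xs → trans (ps≗ xs) (σ≗τ xs)

  id-Prim : ∀ {n} → PrimVec {n} λ xs → xs
  id-Prim = PrimVec-≗ tabulate∘lookup (projections-Prim λ i → i)

  tail-Prim : ∀ {n} → PrimVec (tail {n = n})
  tail-Prim = PrimVec-≗ (λ { (_ ∷ xs) → tabulate∘lookup xs }) (projections-Prim suc)

  substitute-Prim : ∀ {m n} {G : Vec ℕ m → ℕ} {σ : Vec ℕ n → Vec ℕ m} →
    Prim G → PrimVec σ → Prim λ xs → G (σ xs)
  substitute-Prim {G = G} (p , p≗) (ps , ps≗) =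
    comp p ps , λ xs → trans (p≗ _) (cong G (ps≗ xs))

  substituteVec-Prim : ∀ {l m n} {τ : Vec ℕ m → Vec ℕ l} {σ : Vec ℕ n → Vec ℕ m} →
    PrimVec τ → PrimVec σ → PrimVec λ xs → τ (σ xs)
  substituteVec-Prim {τ = τ} ([]     , τ≗) ps         = [] , λ xs → τ≗ _
  substituteVec-Prim {τ = τ} (q ∷ qs , τ≗) (ps , ps≗) =
    let rs , rs≗ = substituteVec-Prim (qs , λ _ → refl) (ps , λ _ → refl) in
    comp q ps ∷ rs , λ xs → trans (cong (_ ∷_) (rs≗ xs)) (trans (τ≗ _) (cong τ (ps≗ xs)))

  drop-value : ∀ {n} {F : Vec ℕ (suc n) → ℕ} →
    Prim F → Prim λ (xs : Vec ℕ (2 + n)) → F (x₀ xs ∷ tail (tail xs))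
  drop-value p = substitute-Prim p (v₀ ∷-Prim substituteVec-Prim tail-Prim tail-Prim)

  Prim-case : ∀ {n} {F : Vec ℕ (suc n) → ℕ} →
    Prim (λ xs → F (0 ∷ xs)) → Prim (λ xs → F (suc (x₀ xs) ∷ tail xs)) → Prim F
  Prim-case z s = Prim-rec z (drop-value s) (λ _ _ → refl)

  suc-Prim : Prim₁ suc
  suc-Prim = prim₁ (suc , λ { (x ∷ []) → refl })

  +-Prim : Prim₂ _+_
  +-Prim = prim₂ (Prim-rec v₀ (compose₁ suc-Prim v₁) (λ _ _ → refl))

  pred-Prim : Prim₁ pred
  pred-Prim = prim₁ (Prim-case (const-Prim 0) v₀)

  ∸-Prim : Prim₂ _∸_
  ∸-Prim = prim₂ (compose₂ flipped v₁ v₀)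
    where
    flipped : Prim₂ λ y x → x ∸ y
    flipped = prim₂ (Prim-rec v₀ (compose₁ pred-Prim v₁)
      λ k xs → sym (pred[m∸n]≡m∸[1+n] (x₀ xs) k))

  choose : ℕ → ℕ → ℕ → ℕ
  choose zero    x y = y
  choose (suc _) x y = x

  choose-Prim : Prim₃ choose
  choose-Prim = prim₃ (Prim-case v₁ v₁)

  if-Prim : ∀ {n} {b : Vec ℕ n → Bool} {A B : Vec ℕ n → ℕ} →
    Prim (bit ∘ b) → Prim A → Prim B → Prim λ xs → if b xs then A xs else B xs
  if-Prim {b = b} pb pa pc = Prim-≗ (λ xs → lemma (b xs)) (compose₃ choose-Prim pb pa pc)
    where
    lemma : ∀ b {x y} → choose (bit b) x y ≡ (if b then x else y)
    lemma true  = refl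
    lemma false = refl

  not-Prim : ∀ {n} {b : Vec ℕ n → Bool} → Prim (bit ∘ b) → Prim (bit ∘ not ∘ b)
  not-Prim {b = b} pb =
    Prim-≗ (λ xs → lemma (b xs)) (if-Prim pb (const-Prim 0) (const-Prim 1))
    where
    lemma : ∀ b → (if b then 0 else 1) ≡ bit (not b)
    lemma true  = refl
    lemma false = refl

  ∧-Prim : ∀ {n} {b c : Vec ℕ n → Bool} →
    Prim (bit ∘ b) → Prim (bit ∘ c) → Prim λ xs → bit (b xs ∧ c xs)
  ∧-Prim {b = b} pb pc =
    Prim-≗ (λ xs → lemma (b xs)) (if-Prim pb pc (const-Prim 0))
    where
    lemma : ∀ b {c} → (if b then bit c else 0) ≡ bit (b ∧ c)
    lemma true  = refl
    lemma false = refl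

  <ᵇ-Prim : Prim₂ λ x y → bit (x <ᵇ y)
  <ᵇ-Prim = prim₂ (Prim-≗ (λ xs → lemma (x₀ xs) (x₁ xs))
    (compose₃ choose-Prim (compose₂ ∸-Prim v₁ v₀) (const-Prim 1) (const-Prim 0)))
    where
    lemma : ∀ x y → choose (y ∸ x) 1 0 ≡ bit (x <ᵇ y)
    lemma zero    zero    = refl
    lemma zero    (suc y) = refl
    lemma (suc x) zero    = refl
    lemma (suc x) (suc y) = lemma x y

  ≡ᵇ-Prim : Prim₂ λ x y → bit (x ≡ᵇ y)
  ≡ᵇ-Prim = prim₂ (Prim-≗ (λ xs → lemma (x₀ xs) (x₁ xs))
    (compose₃ choose-Prim
      (compose₂ +-Prim (compose₂ ∸-Prim v₀ v₁) (compose₂ ∸-Prim v₁ v₀))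
      (const-Prim 0) (const-Prim 1)))
    where
    lemma : ∀ x y → choose ((x ∸ y) + (y ∸ x)) 0 1 ≡ bit (x ≡ᵇ y)
    lemma zero    zero    = refl
    lemma zero    (suc y) = refl
    lemma (suc x) zero    = refl
    lemma (suc x) (suc y) = lemma x y

  fold-Prim : ∀ {f} → Prim₁ f → Prim₂ λ n x → fold x f n
  fold-Prim pf = prim₂ (Prim-rec v₀ (compose₁ pf v₁) (λ _ _ → refl))

  any-Prim : ∀ {n} {p : ℕ → Vec ℕ n → Bool} {A : Vec ℕ n → ℕ} →
    Prim (λ xs → bit (p (x₀ xs) (tail xs))) → Prim A →
    Prim λ xs → bit (any< (λ i → p i xs) (A xs))
  any-Prim {n} {p} {A} pp pa = substitute-Prim search (pa ∷-Prim id-Prim)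
    where
    lemma : ∀ b {c} → bit (b ∨ c) ≡ (if b then 1 else bit c)
    lemma true  = refl
    lemma false = refl
    search : Prim λ xs → bit (any< (λ i → p i (tail xs)) (x₀ xs))
    search = Prim-rec (const-Prim 0) (if-Prim (drop-value pp) (const-Prim 1) v₁)
      λ k xs → lemma (p k xs)

  triangle-Prim : Prim₁ triangle
  triangle-Prim = prim₁ (Prim-rec (const-Prim 0)
    (compose₂ +-Prim (compose₁ suc-Prim v₀) v₁) (λ _ _ → refl))

  diagonal-Prim : Prim₁ diagonal
  diagonal-Prim = prim₁ (Prim-rec (const-Prim 0)
    (if-Prim (compose₂ <ᵇ-Prim (compose₁ suc-Prim v₀)
                               (compose₁ triangle-Prim (compose₁ suc-Prim v₁)))
             v₁ (compose₁ suc-Prim v₁))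
    (λ _ _ → refl))

  opaque
    unfolding pair

    pair-Prim : Prim₂ pair
    pair-Prim = prim₂ (compose₂ +-Prim v₀ (compose₁ triangle-Prim (compose₂ +-Prim v₀ v₁)))

    left-Prim : Prim₁ left
    left-Prim = prim₁ (compose₂ ∸-Prim v₀ (compose₁ triangle-Prim (compose₁ diagonal-Prim v₀)))

    right-Prim : Prim₁ right
    right-Prim = prim₁ (compose₂ ∸-Prim (compose₁ diagonal-Prim v₀) (compose₁ left-Prim v₀))

-- Isomorphism of injection structures

fold-comm : ∀ {A : Set} (f : A → A) x m n → fold (fold x f m) f n ≡ fold (fold x f n) f m
fold-comm f x m n = begin
  fold (fold x f m) f n  ≡⟨ fold-+ x f n ⟨
  fold x f (n + m)       ≡⟨ cong (fold x f) (+-comm n m) ⟩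
  fold x f (m + n)       ≡⟨ fold-+ x f m ⟩
  fold (fold x f n) f m  ∎
  where open ≡-Reasoning

fold-injective : ∀ {A : Set} {f : A → A} → Injective _≡_ _≡_ f →
  ∀ n {x y} → fold x f n ≡ fold y f n → x ≡ y
fold-injective inj zero    eq = eq
fold-injective inj (suc n) eq = fold-injective inj n (inj eq)

fold-+-cancel : ∀ {A : Set} {f : A → A} → Injective _≡_ _≡_ f →
  ∀ m {n} {x y} → fold x f m ≡ fold y f (m + n) → x ≡ fold y f n
fold-+-cancel {f = f} inj m {y = y} eq = fold-injective inj m (trans eq (fold-+ y f m))

-- For injective `f` this is the relation `Orbit`; with a common forward image, transitivity needs
-- no case distinction on directions.
SameOrbit : {A : Set} → (A → A) → A → A → Set
SameOrbit f x y = ∃[ m ] ∃[ n ] fold x f m ≡ fold y f n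

Aperiodic : {A : Set} → (A → A) → A → Set
Aperiodic f x = ∀ n → ¬ fold x f (suc n) ≡ x

Initial : {A : Set} → (A → A) → A → Set
Initial f x = ∀ y → ¬ f y ≡ x

Backward : {A : Set} → (A → A) → A → Set
Backward f x = ∀ n → ∃[ y ] fold y f n ≡ x

module _ {A : Set} {f : A → A} where

  same-refl : ∀ {x} → SameOrbit f x x
  same-refl = 0 , 0 , refl

  same-sym : ∀ {x y} → SameOrbit f x y → SameOrbit f y x
  same-sym (m , n , eq) = n , m , sym eq

  same-trans : ∀ {x y z} → SameOrbit f x y → SameOrbit f y z → SameOrbit f x z
  same-trans {x} {y} {z} (m , n , eq) (p , q , eq′) = p + m , n + q , (begin
    fold x f (p + m)       ≡⟨ fold-+ x f p ⟩
    fold (fold x f m) f p  ≡⟨ cong (λ w → fold w f p) eq ⟩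
    fold (fold y f n) f p  ≡⟨ fold-comm f y n p ⟩
    fold (fold y f p) f n  ≡⟨ cong (λ w → fold w f n) eq′ ⟩
    fold (fold z f q) f n  ≡⟨ fold-+ z f n ⟨
    fold z f (n + q)       ∎)
    where open ≡-Reasoning

  same-step : ∀ {x} → SameOrbit f (f x) x
  same-step = 0 , 1 , refl

  same-fold : ∀ {x} n → SameOrbit f (fold x f n) x
  same-fold n = 0 , n , refl

  initial⇒aperiodic : ∀ {x} → Initial f x → Aperiodic f x
  initial⇒aperiodic init n eq = init _ eq

  same-invariant : {B : Set} (label : A → B) → (∀ x → label (f x) ≡ label x) →
    ∀ {x y} → SameOrbit f x y → label x ≡ label y
  same-invariant label step (m , n , eq) =
    trans (sym (lemma m)) (trans (cong label eq) (lemma n))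
    where
    lemma : ∀ n {x} → label (fold x f n) ≡ label x
    lemma zero    = refl
    lemma (suc n) = trans (step _) (lemma n)

  module _ (f-injective : Injective _≡_ _≡_ f) where

    backward-same : ∀ {x y} → SameOrbit f x y → Backward f x → Backward f y
    backward-same {x} {y} (m , n , eq) back k = let w , eq′ = back (n + k) in
      fold w f m , sym (fold-injective f-injective n (begin
        fold y f n                       ≡⟨ eq ⟨
        fold x f m                       ≡⟨ cong (λ x → fold x f m) eq′ ⟨
        fold (fold w f (n + k)) f m      ≡⟨ fold-comm f w (n + k) m ⟩
        fold (fold w f m) f (n + k)      ≡⟨ fold-+ _ f n ⟩
        fold (fold (fold w f m) f k) f n ∎))
      where open ≡-Reasoning

    aperiodic-same : ∀ {x y} → SameOrbit f x y → Aperiodic f x → Aperiodic f y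
    aperiodic-same {x} {y} (m , n , eq) ap k per = ap k (fold-injective f-injective m (begin
      fold (fold x f (suc k)) f m ≡⟨ fold-comm f x (suc k) m ⟩
      fold (fold x f m) f (suc k) ≡⟨ cong (λ x → fold x f (suc k)) eq ⟩
      fold (fold y f n) f (suc k) ≡⟨ fold-comm f y n (suc k) ⟩
      fold (fold y f (suc k)) f n ≡⟨ cong (λ x → fold x f n) per ⟩
      fold y f n                  ≡⟨ eq ⟨
      fold x f m                  ∎))
      where open ≡-Reasoning

    periodic⇒backward : ∀ {x} k → fold x f (suc k) ≡ x → Backward f x
    periodic⇒backward {x} k per zero    = x , refl
    periodic⇒backward {x} k per (suc n) = let y , eq = periodic⇒backward k per n in
      -- On a cycle of length `k + 1`, going `k` steps forward undoes one step.
      fold y f k , (begin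
        fold (fold y f k) f (suc n) ≡⟨ fold-comm f y k (suc n) ⟩
        fold (f (fold y f n)) f k   ≡⟨ cong (λ z → fold (f z) f k) eq ⟩
        fold (f x) f k              ≡⟨ fold-comm f x 1 k ⟩
        fold x f (suc k)            ≡⟨ per ⟩
        x                           ∎)
      where open ≡-Reasoning

-- The isomorphism type of an orbit is determined by its period and by
-- whether it extends backwards for ever.
record Matching {A B I : Set} (f : A → A) (g : B → B)
                (Valid : I → Set) (r : I → A) (s : I → B) : Set where
  field
    f-injective : Injective _≡_ _≡_ f
    g-injective : Injective _≡_ _≡_ g
    f-cover     : ∀ x → ∃[ i ] Valid i × SameOrbit f x (r i)
    g-cover     : ∀ y → ∃[ i ] Valid i × SameOrbit g y (s i)
    f-separate  : ∀ {i j} → Valid i → Valid j → SameOrbit f (r i) (r j) → i ≡ j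
    g-separate  : ∀ {i j} → Valid i → Valid j → SameOrbit g (s i) (s j) → i ≡ j
    periods     : ∀ {i} → Valid i → ∀ n → fold (r i) f n ≡ r i ⇔ fold (s i) g n ≡ s i
    ends        : ∀ {i} → Valid i → (Backward f (r i) × Backward g (s i)) ⊎
                                    (Initial f (r i) × Initial g (s i))

matching-sym : ∀ {A B I : Set} {f : A → A} {g : B → B} {Valid : I → Set} {r s} →
  Matching f g Valid r s → Matching g f Valid s r
matching-sym μ = record
  { f-injective = g-injective ; g-injective = f-injective
  ; f-cover     = g-cover     ; g-cover     = f-cover
  ; f-separate  = g-separate  ; g-separate  = f-separate
  ; periods     = λ v n → let eqv = periods v n in mk⇔ (Equivalence.from eqv) (Equivalence.to eqv)
  ; ends        = λ v → Sum.map swap swap (ends v)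
  }
  where open Matching μ

module Correspondence {A B I : Set} {f : A → A} {g : B → B} {Valid : I → Set}
                      {r : I → A} {s : I → B} (μ : Matching f g Valid r s) where
  open Matching μ

  -- Both elements are reached from their representatives by `n` steps forward and `m` steps back,
  -- with the same `m` and `n`.
  Related : A → B → Set
  Related x y = ∃[ i ] Valid i × ∃[ m ] ∃[ n ]
    fold x f m ≡ fold (r i) f n × fold y g m ≡ fold (s i) g n

  transfer-≤ : ∀ {i} → Valid i → ∀ {m n} → m ≤ n →
    fold (r i) f m ≡ fold (r i) f n → fold (s i) g m ≡ fold (s i) g n
  transfer-≤ {i} v {m} {n} m≤n eq = begin
    fold (s i) g m              ≡⟨ cong (λ y → fold y g m) (Equivalence.to (periods v k) period) ⟨
    fold (fold (s i) g k) g m   ≡⟨ fold-+ (s i) g m ⟨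
    fold (s i) g (m + k)        ≡⟨ cong (fold (s i) g) (m+[n∸m]≡n m≤n) ⟩
    fold (s i) g n              ∎
    where
    open ≡-Reasoning
    k = n ∸ m
    period : fold (r i) f k ≡ r i
    period = sym (fold-+-cancel f-injective m
      (trans eq (cong (fold (r i) f) (sym (m+[n∸m]≡n m≤n)))))

  transfer : ∀ {i} → Valid i → ∀ m n →
    fold (r i) f m ≡ fold (r i) f n → fold (s i) g m ≡ fold (s i) g n
  transfer v m n eq with ≤-total m n
  ... | inj₁ m≤n = transfer-≤ v m≤n eq
  ... | inj₂ n≤m = sym (transfer-≤ v n≤m (sym eq))

  -- If the orbit extends backwards for ever, the `m` steps back can be taken in `g`. If it starts
  -- at the representative, then `m ≤ n`: cancelling `n` steps would otherwise exhibit `r i` as a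
  -- value of `f`.
  partner : ∀ x → ∃[ y ] Related x y
  partner x with f-cover x
  ... | i , v , m , n , eq with ends v
  ...   | inj₁ (_ , back) = let y , eq′ = back m in
    fold y g n , i , v , m , n , eq ,
    trans (fold-comm g y n m) (cong (λ z → fold z g n) eq′)
  ...   | inj₂ (init , _) with m ≤? n
  ...     | yes m≤n = fold (s i) g (n ∸ m) , i , v , m , n , eq ,
    trans (sym (fold-+ (s i) g m)) (cong (fold (s i) g) (m+[n∸m]≡n m≤n))
  ...     | no m≰n = let k , n+k≡m = m≤n⇒∃[o]m+o≡n (≰⇒> m≰n) in contradiction
    (sym (fold-+-cancel f-injective n (begin
      fold (r i) f n         ≡⟨ eq ⟨
      fold x f m             ≡⟨ cong (fold x f) (trans (sym n+k≡m) (sym (+-suc n k))) ⟩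
      fold x f (n + suc k)   ∎)))
    (init (fold x f k))
    where open ≡-Reasoning

  -- Separation forces the same index. Moving both candidates `m′ + m` steps forward leaves two
  -- iterates of `s i`, which agree because the corresponding iterates of `r i` do.
  unique : ∀ {x y y′} → Related x y → Related x y′ → y ≡ y′
  unique {x} {y} {y′} (i , v , m , n , x∼ , y∼) (j , w , m′ , n′ , x∼′ , y∼′)
    with refl ← f-separate v w (same-trans (n , m , sym x∼) (m′ , n′ , x∼′)) =
    fold-injective g-injective (m′ + m) (begin
      fold y g (m′ + m)   ≡⟨ lift g m′ m n y∼ ⟩
      fold (s i) g (m′ + n) ≡⟨ transfer v (m′ + n) (m + n′) (trans (sym (lift f m′ m n x∼))
                              (trans (cong (fold x f) (+-comm m′ m)) (lift f m m′ n′ x∼′))) ⟩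
      fold (s i) g (m + n′) ≡⟨ lift g m m′ n′ y∼′ ⟨
      fold y′ g (m + m′)  ≡⟨ cong (fold y′ g) (+-comm m m′) ⟩
      fold y′ g (m′ + m)  ∎)
    where
    open ≡-Reasoning
    lift : ∀ {A : Set} (h : A → A) k m n {x y} → fold x h m ≡ fold y h n →
      fold x h (k + m) ≡ fold y h (k + n)
    lift h k m n {x} {y} eq =
      trans (fold-+ x h k) (trans (cong (λ z → fold z h k) eq) (sym (fold-+ y h k)))

  related-step : ∀ {x y} → Related x y → Related (f x) (g y)
  related-step {x} {y} (i , v , m , n , x∼ , y∼) = i , v , m , suc n ,
    trans (fold-comm f x 1 m) (cong f x∼) , trans (fold-comm g y 1 m) (cong g y∼)

-- `Related` is symmetric in the two structures, so the partners in the two directions are mutually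
-- inverse by uniqueness.
isomorphism : ∀ {A B I : Set} {f : A → A} {g : B → B} {Valid : I → Set}
  {r : I → A} {s : I → B} → Matching f g Valid r s →
  Σ[ θ ∈ A ↔ B ] ∀ x → Inverse.to θ (f x) ≡ g (Inverse.to θ x)
isomorphism {f = f} {g} μ =
  mk↔ₛ′ there back
    (λ y → F.unique (proj₂ (F.partner (back y))) (flip-related (proj₂ (G.partner y))))
    (λ x → G.unique (proj₂ (G.partner (there x))) (flip-related′ (proj₂ (F.partner x)))) ,
  λ x → F.unique (proj₂ (F.partner (f x))) (F.related-step (proj₂ (F.partner x)))
  where
  module F = Correspondence μ
  module G = Correspondence (matching-sym μ)
  there = λ x → proj₁ (F.partner x)
  back  = λ y → proj₁ (G.partner y)
  flip-related : ∀ {x y} → G.Related y x → F.Related x y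
  flip-related (i , v , m , n , p , q) = i , v , m , n , q , p
  flip-related′ : ∀ {x y} → F.Related x y → G.Related y x
  flip-related′ (i , v , m , n , p , q) = i , v , m , n , q , p

-- Least witnesses and minimal periods

≡ᵇ-true⇒≡ : ∀ {m n} → (m ≡ᵇ n) ≡ true → m ≡ n
≡ᵇ-true⇒≡ {m} {n} eq = ≡ᵇ⇒≡ m n (Equivalence.from T-≡ eq)

≡⇒≡ᵇ-true : ∀ {m n} → m ≡ n → (m ≡ᵇ n) ≡ true
≡⇒≡ᵇ-true {m} {n} eq = Equivalence.to T-≡ (≡⇒≡ᵇ m n eq)

true≢false : {A : Set} {b : Bool} → b ≡ true → b ≡ false → A
true≢false refl ()

bool-ext : ∀ {b c} → (b ≡ true → c ≡ true) → (c ≡ true → b ≡ true) → b ≡ c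
bool-ext {true}  {c}     f g = sym (f refl)
bool-ext {false} {true}  f g = g refl
bool-ext {false} {false} f g = refl

least : ExcludedMiddle 0ℓ → (P : ℕ → Set) → ∃ P → ∃[ n ] P n × ∀ {m} → P m → n ≤ m
least em P (n , Pn) = search n ≤-refl Pn
  where
  search : ∀ k {n} → n ≤ k → P n → ∃[ n ] P n × ∀ {m} → P m → n ≤ m
  search k {n} n≤k Pn with em {∃[ m ] m < n × P m}
  ... | no  ∄ = n , Pn , λ Pm → ≮⇒≥ λ m<n → ∄ (_ , m<n , Pm)
  search zero    z≤n Pn | yes (_ , () , _)
  search (suc k) n≤k Pn | yes (m , m<n , Pm) = search k (s≤s⁻¹ (<-≤-trans m<n n≤k)) Pm

-- All tests are bounded by `k`, which makes this primitive recursive in `f`; whether an element has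
-- any period at all need not be decidable.
exactPeriod : (ℕ → ℕ) → ℕ → ℕ → Bool
exactPeriod f k y = (fold y f (suc k) ≡ᵇ y) ∧ not (any< (λ i → fold y f (suc i) ≡ᵇ y) k)

exactPeriod-elim : ∀ f k y → exactPeriod f k y ≡ true →
  fold y f (suc k) ≡ y × (∀ {i} → fold y f (suc i) ≡ y → k ≤ i)
exactPeriod-elim f k y eq with fold y f (suc k) ≡ᵇ y in per
... | true with any< (λ i → fold y f (suc i) ≡ᵇ y) k in none
...   | false = ≡ᵇ-true⇒≡ per , λ eq′ → ≮⇒≥ λ i<k →
  true≢false (any<-intro _ i<k (≡⇒≡ᵇ-true eq′)) none

exactPeriod-intro : ∀ f k y → fold y f (suc k) ≡ y → (∀ {i} → fold y f (suc i) ≡ y → k ≤ i) →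
  exactPeriod f k y ≡ true
exactPeriod-intro f k y per minimal
  rewrite ≡⇒≡ᵇ-true per with any< (λ i → fold y f (suc i) ≡ᵇ y) k in some
... | false = refl
... | true  = let i , i<k , eq = any<-elim _ k some in
  contradiction i<k (≤⇒≯ (minimal (≡ᵇ-true⇒≡ eq)))

exactPeriod-step : ∀ {f} → Injective _≡_ _≡_ f → ∀ k y →
  exactPeriod f k (f y) ≡ exactPeriod f k y
exactPeriod-step {f} inj k y = bool-ext
  (λ eq → let per , minimal = exactPeriod-elim f k (f y) eq in
    exactPeriod-intro f k y (down (suc k) per) (λ {i} eq′ → minimal (up (suc i) eq′)))
  (λ eq → let per , minimal = exactPeriod-elim f k y eq in
    exactPeriod-intro f k (f y) (up (suc k) per) (λ {i} eq′ → minimal (down (suc i) eq′)))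
  where
  up : ∀ n → fold y f n ≡ y → fold (f y) f n ≡ f y
  up n eq = trans (fold-comm f y 1 n) (cong f eq)
  down : ∀ n → fold (f y) f n ≡ f y → fold y f n ≡ y
  down n eq = inj (trans (sym (fold-comm f y 1 n)) eq)

-- Punctual copies

-- main m is the m-th element of the main chain; col u and neg u are the two
-- halves of a chain; cyc k y stands for y itself when y has period k + 1.
data Element : Set where
  main : ℕ → Element
  col neg cyc : ℕ → ℕ → Element

code : Element → ℕ
code (main m)  = pair 0 m
code (col u v) = pair 1 (pair u v)
code (neg u v) = pair 2 (pair u v)
code (cyc k y) = pair (3 + k) y

tagged : ℕ → ℕ → Element
tagged 0 y = main y
tagged 1 y = col (left y) (right y)
tagged 2 y = neg (left y) (right y)
tagged (suc (suc (suc k))) y = cyc k y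

decode : ℕ → Element
decode x = tagged (left x) (right x)

decode-code : ∀ x → decode (code x) ≡ x
decode-code (main m)  = cong₂ tagged (left-pair 0 m) (right-pair 0 m)
decode-code (col u v) = trans (cong₂ tagged (left-pair 1 (pair u v)) (right-pair 1 (pair u v)))
                              (cong₂ col (left-pair u v) (right-pair u v))
decode-code (neg u v) = trans (cong₂ tagged (left-pair 2 (pair u v)) (right-pair 2 (pair u v)))
                              (cong₂ neg (left-pair u v) (right-pair u v))
decode-code (cyc k y) = cong₂ tagged (left-pair (3 + k) y) (right-pair (3 + k) y)

code-decode : ∀ x → code (decode x) ≡ x
code-decode x = trans (lemma (left x) (right x)) (pair-left-right x)
  where
  lemma : ∀ t y → code (tagged t y) ≡ pair t y
  lemma 0 y = refl
  lemma 1 y = cong (pair 1) (pair-left-right y)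
  lemma 2 y = cong (pair 2) (pair-left-right y)
  lemma (suc (suc (suc k))) y = refl

Element↔ℕ : Element ↔ ℕ
Element↔ℕ = mk↔ₛ′ code decode code-decode decode-code

-- F u: there is a u-th infinite orbit, and N u: it is a ζ-chain.  The orbit u₀
-- has the main chain in the place of its column.  Column u is finite if F u
-- fails: it ends at the first v with R u v and is then inserted into the main
-- chain, between main m and main (suc m) for m the code of its last element.
-- The codes beyond this end, and the superfluous neg u v and cyc k y, are
-- inserted likewise, as blocks of length one.
module Copy (f : ℕ → ℕ) (F N : ℕ → Bool) (u₀ : ℕ) (R : ℕ → ℕ → Bool) where

  released : ℕ → ℕ → Bool
  released u v = if F u then u ≡ᵇ u₀ else R u v

  last : Element → Bool
  last (main _)  = false
  last (col u v) = released u v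
  last (neg u _) = not (N u)
  last (cyc k y) = not (exactPeriod f k y)

  -- For the last element of a block: if its predecessor in the column is already released, the
  -- block proper ended earlier and this is a block of length one; otherwise the block is the whole
  -- column up to here.
  start : Element → Element
  start (col u (suc v)) = if released u v then col u (suc v) else col u 0
  start x               = x

  base : ℕ → Element
  base u = if u ≡ᵇ u₀ then main 0 else col u 0

  above : ℕ → ℕ → Element
  above u zero    = base u
  above u (suc v) = neg u v

  after : Element → Element
  after x = main (suc (code x))

  G : Element → Element
  G (main m)  = if last (decode m) then start (decode m) else main (suc m)
  G (col u v) = if released u v then after (col u v) else col u (suc v)
  G (neg u v) = if N u then above u v else after (neg u v)
  G (cyc k y) = if exactPeriod f k y then cyc k (f y) else after (cyc k y)

-- Injectivity and orbits of the copy

data Index : Set where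
  inf : ℕ → Index
  fin : ℕ → ℕ → Index

module CopyProperties
  (em : ExcludedMiddle 0ℓ) (f : ℕ → ℕ) (F N : ℕ → Bool) (u₀ : ℕ) (R : ℕ → ℕ → Bool)
  (f-injective : Injective _≡_ _≡_ f)
  (F-u₀ : F u₀ ≡ true) (N⇒F : ∀ u → N u ≡ true → F u ≡ true)
  (R-mono : ∀ u v → R u v ≡ true → R u (suc v) ≡ true)
  (R-total : ∀ u → ∃[ v ] R u v ≡ true) where

  open Copy f F N u₀ R

  released-suc : ∀ u v → released u v ≡ true → released u (suc v) ≡ true
  released-suc u v r with F u
  ... | true  = r
  ... | false = R-mono u v r

  released-mono : ∀ u {v w} → v ≤ w → released u v ≡ true → released u w ≡ true
  released-mono u {v} v≤w r with k , refl ← m≤n⇒∃[o]m+o≡n v≤w = lemma k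
    where
    lemma : ∀ k → released u (v + k) ≡ true
    lemma zero    = subst (λ w → released u w ≡ true) (sym (+-identityʳ v)) r
    lemma (suc k) = subst (λ w → released u w ≡ true) (sym (+-suc v k))
                          (released-suc u (v + k) (lemma k))

  permanent : ∀ u v → F u ≡ true → (u ≡ᵇ u₀) ≡ false → released u v ≡ false
  permanent u v Fu u≢u₀ rewrite Fu = u≢u₀

  predCol : (u : ℕ) → Dec (∃[ v ] released u v ≡ true) → Element
  predCol u (yes r) = main (code (col u (proj₁ (least em (λ v → released u v ≡ true) r))))
  predCol u (no _)  = neg u 0

  -- A left inverse of `G`. It is classical, since the predecessor of `col u 0` depends on whether
  -- column `u` is ever released. On `base u` the value `neg u 0` is the true predecessor in a
  -- ζ-chain and a default in an ω-chain; `base-initial` exploits the default.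
  H : Element → Element
  H (main zero)     = neg u₀ 0
  H (main (suc m))  = if last (decode m) then decode m else main m
  H (col u zero)    = predCol u em
  H (col u (suc v)) = if released u v then main (code (col u (suc v))) else col u v
  H (neg u v)       = if N u then neg u (suc v) else main (code (neg u v))
  H (cyc k y)       = if exactPeriod f k y then cyc k (fold y f k) else main (code (cyc k y))

  predCol-first : ∀ u v → released u v ≡ true → (∀ w → released u w ≡ true → v ≤ w) →
    ∀ d → predCol u d ≡ main (code (col u v))
  predCol-first u v r first (no ∄)  = contradiction (v , r) ∄
  predCol-first u v r first (yes e) with least em (λ v → released u v ≡ true) e
  ... | w , rw , minimal = cong (main ∘ code ∘ col u) (≤-antisym (minimal r) (first w rw))

  H-base : ∀ u → F u ≡ true → H (base u) ≡ neg u 0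
  H-base u Fu with u ≡ᵇ u₀ in eq
  ... | true = cong (λ u → neg u 0) (sym (≡ᵇ-true⇒≡ eq))
  ... | false with em {∃[ v ] released u v ≡ true}
  ...   | yes (v , r) = true≢false r (permanent u v Fu eq)
  ...   | no _        = refl

  H-start : ∀ x → last x ≡ true → H (start x) ≡ main (code x)
  H-start (col u zero)    l = predCol-first u 0 l (λ _ _ → z≤n) em
  H-start (col u (suc v)) l with released u v in r
  ... | true  rewrite r = refl
  ... | false = predCol-first u (suc v) l
    (λ w rw → ≰⇒> λ w≤v → true≢false (released-mono u w≤v rw) r) em
  H-start (neg u v)       l with N u
  ... | false = refl
  H-start (cyc k y)       l with exactPeriod f k y
  ... | false = refl

  H-after : ∀ x → last x ≡ true → H (after x) ≡ x
  H-after x l rewrite decode-code x | l = refl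

  H-G : ∀ x → H (G x) ≡ x
  H-G (main m) with last (decode m) in l
  ... | true  = trans (H-start (decode m) l) (cong main (code-decode m))
  ... | false rewrite l = refl
  H-G (col u v) with released u v in r
  ... | true  = H-after (col u v) r
  ... | false rewrite r = refl
  H-G (neg u zero) with N u in Nu
  ... | true  = H-base u (N⇒F u Nu)
  ... | false = H-after (neg u 0) (cong not Nu)
  H-G (neg u (suc v)) with N u in Nu
  ... | true  rewrite Nu = refl
  ... | false = H-after (neg u (suc v)) (cong not Nu)
  H-G (cyc k y) with exactPeriod f k y in per
  ... | false = H-after (cyc k y) (cong not per)
  ... | true  rewrite exactPeriod-step f-injective k y | per =
    cong (cyc k) (trans (fold-comm f y 1 k) (proj₁ (exactPeriod-elim f k y per)))

  G-injective : Injective _≡_ _≡_ G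
  G-injective {x} {y} eq = trans (sym (H-G x)) (trans (cong H eq) (H-G y))

  G-last : ∀ x → last x ≡ true → G x ≡ after x
  G-last (col u v) l rewrite l = refl
  G-last (neg u v) l with N u
  ... | false = refl
  G-last (cyc k y) l with exactPeriod f k y
  ... | false = refl

  G-neg : ∀ u → N u ≡ true → ∀ v → G (neg u v) ≡ above u v
  G-neg u Nu v rewrite Nu = refl

  G-col : ∀ u v → released u v ≡ false → G (col u v) ≡ col u (suc v)
  G-col u v r rewrite r = refl

  col-run : ∀ u n → (∀ v → v < n → released u v ≡ false) → fold (col u 0) G n ≡ col u n
  col-run u zero    r = refl
  col-run u (suc n) r =
    trans (cong G (col-run u n λ v v<n → r v (m<n⇒m<1+n v<n))) (G-col u n (r n ≤-refl))

  neg-run : ∀ u → N u ≡ true → ∀ v w → fold (neg u (v + w)) G v ≡ neg u w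
  neg-run u Nu zero    w = refl
  neg-run u Nu (suc v) w = trans
    (cong (λ k → G (fold (neg u k) G v)) (sym (+-suc v w)))
    (trans (cong G (neg-run u Nu v (suc w))) (G-neg u Nu (suc w)))

  neg-base : ∀ u → N u ≡ true → ∀ v → fold (neg u v) G (suc v) ≡ base u
  neg-base u Nu v = trans
    (cong (λ k → G (fold (neg u k) G v)) (sym (+-identityʳ v)))
    (trans (cong G (neg-run u Nu v 0)) (G-neg u Nu 0))

  cyc-run : ∀ k y → exactPeriod f k y ≡ true → ∀ n → fold (cyc k y) G n ≡ cyc k (fold y f n)
  cyc-run k y per zero    = refl
  cyc-run k y per (suc n) = trans (cong G (cyc-run k y per n)) (step (persists n))
    where
    persists : ∀ n → exactPeriod f k (fold y f n) ≡ true
    persists zero    = per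
    persists (suc n) = trans (exactPeriod-step f-injective k _) (persists n)
    step : ∀ {z} → exactPeriod f k z ≡ true → G (cyc k z) ≡ cyc k (f z)
    step per rewrite per = refl

  start-run : ∀ x → last x ≡ true → ∃[ n ] fold (start x) G n ≡ x
  start-run (col u zero)    l = 0 , refl
  start-run (col u (suc v)) l with released u v in r
  ... | true  = 0 , refl
  ... | false = suc v , col-run u (suc v) λ w w≤v →
    ¬-not λ rw → true≢false (released-mono u (s≤s⁻¹ w≤v) rw) r
  start-run (neg u v)       l = 0 , refl
  start-run (cyc k y)       l = 0 , refl

  main-step : ∀ m → ∃[ n ] fold (main m) G (suc n) ≡ main (suc m)
  main-step m with last (decode m) in l
  ... | false = 0 , G-main
    where
    G-main : G (main m) ≡ main (suc m)
    G-main rewrite l = refl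
  ... | true = let n , run = start-run (decode m) l in n + 1 , (begin
    G (fold (main m) G (n + 1))      ≡⟨ cong G (fold-+ (main m) G n) ⟩
    G (fold (G (main m)) G n)        ≡⟨ cong (λ x → G (fold x G n)) G-main ⟩
    G (fold (start (decode m)) G n)  ≡⟨ cong G run ⟩
    G (decode m)                     ≡⟨ G-last (decode m) l ⟩
    main (suc (code (decode m)))     ≡⟨ cong (main ∘ suc) (code-decode m) ⟩
    main (suc m)                     ∎)
    where
    open ≡-Reasoning
    G-main : G (main m) ≡ start (decode m)
    G-main rewrite l = refl

  -- The lower bound `m ≤ n` holds because inserted blocks can only lengthen the way; it turns large
  -- codes into long distances.
  main-run : ∀ m → ∃[ n ] m ≤ n × fold (main 0) G n ≡ main m
  main-run zero    = 0 , z≤n , refl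
  main-run (suc m) =
    let n , m≤n , run = main-run m
        k , step      = main-step m
    in suc k + n , s≤s (≤-trans m≤n (m≤n+m n k)) ,
       trans (fold-+ (main 0) G (suc k)) (trans (cong (λ x → fold x G (suc k)) run) step)

  leastOf : ℕ → ℕ
  leastOf y = proj₁ (least em (SameOrbit f y) (y , same-refl))

  leastOf-same : ∀ y → SameOrbit f y (leastOf y)
  leastOf-same y = proj₁ (proj₂ (least em (SameOrbit f y) (y , same-refl)))

  leastOf-cong : ∀ {x y} → SameOrbit f x y → leastOf x ≡ leastOf y
  leastOf-cong {x} {y} x∼y = ≤-antisym
    (proj₂ (proj₂ (least em (SameOrbit f x) (x , same-refl))) (same-trans x∼y (leastOf-same y)))
    (proj₂ (proj₂ (least em (SameOrbit f y) (y , same-refl)))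
      (same-trans (same-sym x∼y) (leastOf-same x)))

  -- An invariant of `G` that takes the right value on each representative, which separates the
  -- orbits. Everything absorbed by the main chain, finite columns included, gets `inf u₀`.
  label : Element → Index
  label (main _)  = inf u₀
  label (col u _) = inf (if F u then u else u₀)
  label (neg u _) = inf (if N u then u else u₀)
  label (cyc k y) = if exactPeriod f k y then fin k (leastOf y) else inf u₀

  Valid : Index → Set
  Valid (inf u)   = F u ≡ true
  Valid (fin k c) = exactPeriod f k c ≡ true × leastOf c ≡ c

  representative : Index → Element
  representative (inf u)   = base u
  representative (fin k c) = cyc k c

  exactPeriod-same : ∀ k {x y} → SameOrbit f x y → exactPeriod f k x ≡ exactPeriod f k y
  exactPeriod-same k = same-invariant (exactPeriod f k) (exactPeriod-step f-injective k)

  fin-valid : ∀ k y → exactPeriod f k y ≡ true → Valid (fin k (leastOf y))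
  fin-valid k y per = trans (sym (exactPeriod-same k (leastOf-same y))) per ,
                      sym (leastOf-cong (leastOf-same y))

  label-valid : ∀ x → Valid (label x)
  label-valid (main _)  = F-u₀
  label-valid (col u v) with F u in Fu
  ... | true  = Fu
  ... | false = F-u₀
  label-valid (neg u v) with N u in Nu
  ... | true  = N⇒F u Nu
  ... | false = F-u₀
  label-valid (cyc k y) with exactPeriod f k y in per
  ... | true  = fin-valid k y per
  ... | false = F-u₀

  label-base : ∀ u → F u ≡ true → label (base u) ≡ inf u
  label-base u Fu with u ≡ᵇ u₀ in eq
  ... | true  = cong inf (sym (≡ᵇ-true⇒≡ eq))
  ... | false rewrite Fu = refl

  label-representative : ∀ {i} → Valid i → label (representative i) ≡ i
  label-representative {inf u}   Fu            = label-base u Fu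
  label-representative {fin k c} (per , least) rewrite per = cong (fin k) least

  label-last : ∀ x → last x ≡ true → label x ≡ inf u₀
  label-last (col u v) l with F u
  ... | true  = cong inf (≡ᵇ-true⇒≡ l)
  ... | false = refl
  label-last (neg u v) l with N u
  ... | false = refl
  label-last (cyc k y) l with exactPeriod f k y
  ... | false = refl

  label-start : ∀ x → label (start x) ≡ label x
  label-start (main _)        = refl
  label-start (col u zero)    = refl
  label-start (col u (suc v)) with released u v
  ... | true  = refl
  ... | false = refl
  label-start (neg u v)       = refl
  label-start (cyc k y)       = refl

  label-G : ∀ x → label (G x) ≡ label x
  label-G (main m) with last (decode m) in l
  ... | true  = trans (label-start (decode m)) (label-last (decode m) l)
  ... | false = refl
  label-G (col u v) with released u v in r
  ... | true  = sym (label-last (col u v) r)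
  ... | false = refl
  label-G (neg u zero) with N u in Nu
  ... | true  = label-base u (N⇒F u Nu)
  ... | false = refl
  label-G (neg u (suc v)) with N u in Nu
  ... | true  rewrite Nu = refl
  ... | false = refl
  label-G (cyc k y) with exactPeriod f k y in per
  ... | true  rewrite exactPeriod-step f-injective k y | per =
    cong (fin k) (leastOf-cong same-step)
  ... | false = refl

  base-u₀ : base u₀ ≡ main 0
  base-u₀ rewrite ≡⇒≡ᵇ-true {u₀} refl = refl

  main-cover : ∀ m → SameOrbit G (main m) (base u₀)
  main-cover m rewrite base-u₀ = let n , _ , run = main-run m in 0 , n , sym run

  last-cover : ∀ x → last x ≡ true → SameOrbit G x (base u₀)
  last-cover x l = same-trans (same-sym same-step)
    (subst (λ y → SameOrbit G y (base u₀)) (sym (G-last x l)) (main-cover _))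

  -- `n` bounds the number of steps left until a released element is met; from there the orbit
  -- continues on the main chain.
  col-cover : ∀ u n v → released u (n + v) ≡ true → SameOrbit G (col u v) (base u₀)
  col-cover u zero    v r = last-cover (col u v) r
  col-cover u (suc n) v r with released u v in r′
  ... | true  = last-cover (col u v) r′
  ... | false = same-trans (same-sym same-step)
    (subst (λ y → SameOrbit G y (base u₀)) (sym (G-col u v r′))
      (col-cover u n (suc v) (subst (λ w → released u w ≡ true) (sym (+-suc n v)) r)))

  cover : ∀ x → SameOrbit G x (representative (label x))
  cover (main m)  = main-cover m
  cover (col u v) with F u in Fu
  ... | false = let w , r = R-total u in
    col-cover u w v (released-mono u (m≤m+n w v)
      (trans (cong (λ b → if b then u ≡ᵇ u₀ else R u w) Fu) r))
  ... | true with u ≡ᵇ u₀ in eq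
  ...   | true  = subst (SameOrbit G (col u v)) base-u₀ (last-cover (col u v)
                    (trans (cong (λ b → if b then u ≡ᵇ u₀ else R u v) Fu) eq))
  ...   | false = 0 , v , sym (col-run u v λ w _ → permanent u w Fu eq)
  cover (neg u v) with N u in Nu
  ... | true  = suc v , 0 , neg-base u Nu v
  ... | false = last-cover (neg u v) (cong not Nu)
  cover (cyc k y) with exactPeriod f k y in per
  ... | false = last-cover (cyc k y) (cong not per)
  ... | true  = let m , n , eq = leastOf-same y in m , n ,
    trans (cyc-run k y per m) (trans (cong (cyc k) eq)
      (sym (cyc-run k (leastOf y) (proj₁ (fin-valid k y per)) n)))

  separate : ∀ {i j} → Valid i → Valid j →
    SameOrbit G (representative i) (representative j) → i ≡ j
  separate vi vj i∼j = trans (sym (label-representative vi))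
    (trans (same-invariant label label-G i∼j) (label-representative vj))

  after≢base : ∀ x u → ¬ after x ≡ base u
  after≢base x u eq with u ≡ᵇ u₀
  after≢base x u () | true
  after≢base x u () | false

  base-initial : ∀ u → F u ≡ true → N u ≡ false → Initial G (base u)
  base-initial u Fu Nu x eq = after≢base (neg u 0) u (begin
    after (neg u 0)  ≡⟨ G-last (neg u 0) (cong not Nu) ⟨
    G (neg u 0)      ≡⟨ cong G (H-base u Fu) ⟨
    G (H (base u))   ≡⟨ cong (G ∘ H) eq ⟨
    G (H (G x))      ≡⟨ cong G (H-G x) ⟩
    G x              ≡⟨ eq ⟩
    base u           ∎)
    where open ≡-Reasoning

  base-backward : ∀ u → N u ≡ true → Backward G (base u)
  base-backward u Nu zero    = base u , refl
  base-backward u Nu (suc n) = neg u n , neg-base u Nu n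

  -- In a ζ-chain, a return to the base could be retraced by `H` through `neg u 0`, `neg u 1` and so
  -- on, until the base itself would have to be some `neg u v`.
  base-aperiodic : ∀ u → F u ≡ true → Aperiodic G (base u)
  base-aperiodic u Fu n eq with N u in Nu
  ... | false = initial⇒aperiodic (base-initial u Fu Nu) n eq
  ... | true  = not-neg n 0 (trans (sym (H-G _)) (trans (cong H eq) (H-base u Fu)))
    where
    base≢neg : ∀ v → ¬ base u ≡ neg u v
    base≢neg v eq with u ≡ᵇ u₀
    base≢neg v () | true
    base≢neg v () | false
    H-neg : ∀ v → H (neg u v) ≡ neg u (suc v)
    H-neg v rewrite Nu = refl
    not-neg : ∀ n v → ¬ fold (base u) G n ≡ neg u v
    not-neg zero    v eq = base≢neg v eq
    not-neg (suc n) v eq = not-neg n (suc v) (trans (sym (H-G _)) (trans (cong H eq) (H-neg v)))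

  -- The block is entered directly after `main m` with `m` the code of `col u v`. This code is at
  -- least `v`, and `main m` is at least `m` steps away. Since `v` is the first released position,
  -- the block begins at the head of the column.
  entry : ∀ u v → released u v ≡ true → (∀ w → released u w ≡ true → v ≤ w) →
    ∃[ n ] v ≤ n × fold (main 0) G n ≡ col u 0
  entry u v r first =
    let n , code≤n , run = main-run (code (col u v))
    in suc n , m≤n⇒m≤1+n (≤-trans (≤-trans (right≤pair u v) (right≤pair 1 (pair u v))) code≤n) ,
       trans (cong G run) (trans G-main (start-first v first))
    where
    G-main : G (main (code (col u v))) ≡ start (col u v)
    G-main rewrite decode-code (col u v) | r = refl
    start-first : ∀ v → (∀ w → released u w ≡ true → v ≤ w) → start (col u v) ≡ col u 0
    start-first zero    first = refl
    start-first (suc v) first with released u v in r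
    ... | true  = contradiction (first v r) (<-irrefl refl)
    ... | false = refl

  aperiodic⇒nonperiodic : ∀ {x} → Aperiodic G x →
    ∀ n k y → fold x G n ≡ cyc k y → exactPeriod f k y ≡ false
  aperiodic⇒nonperiodic {x} ap n k y eq = ¬-not λ per →
    aperiodic-same G-injective (same-sym (same-fold n)) ap k
      (subst (λ z → fold z G (suc k) ≡ z) (sym eq)
        (trans (cyc-run k y per (suc k)) (cong (cyc k) (proj₁ (exactPeriod-elim f k y per)))))

-- The isomorphism between the structure and its copy

record Transversal (f : ℕ → ℕ) (F N : ℕ → Bool) (ρ : ℕ → ℕ) : Set where
  field
    N⇒F       : ∀ u → N u ≡ true → F u ≡ true
    aperiodic : ∀ u → F u ≡ true → Aperiodic f (ρ u)
    backward  : ∀ u → N u ≡ true → Backward f (ρ u)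
    initial   : ∀ u → F u ≡ true → N u ≡ false → Initial f (ρ u)
    separate  : ∀ {u v} → F u ≡ true → F v ≡ true → SameOrbit f (ρ u) (ρ v) → u ≡ v
    cover     : ∀ y → Aperiodic f y → ∃[ u ] F u ≡ true × SameOrbit f y (ρ u)

module CopyIsomorphism
  (em : ExcludedMiddle 0ℓ) (f : ℕ → ℕ) (F N : ℕ → Bool) (u₀ : ℕ) (R : ℕ → ℕ → Bool) (ρ : ℕ → ℕ)
  (f-injective : Injective _≡_ _≡_ f)
  (F-u₀ : F u₀ ≡ true) (transversal : Transversal f F N ρ)
  (R-mono : ∀ u v → R u v ≡ true → R u (suc v) ≡ true)
  (R-total : ∀ u → ∃[ v ] R u v ≡ true) where

  open Copy f F N u₀ R public
  open CopyProperties em f F N u₀ R f-injective F-u₀ (Transversal.N⇒F transversal) R-mono R-total public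
  private module τ = Transversal transversal

  -- The representatives on the side of `f`. Neither `ρ` nor the least elements of cycles are
  -- effective; they enter the isomorphism but not the copy.
  origin : Index → ℕ
  origin (inf u)   = ρ u
  origin (fin k c) = c

  origin-cover : ∀ x → ∃[ i ] Valid i × SameOrbit f x (origin i)
  origin-cover x with em {∃[ k ] fold x f (suc k) ≡ x}
  ... | no  ∄ = let u , Fu , x∼ρ = τ.cover x (λ k per → ∄ (k , per)) in inf u , Fu , x∼ρ
  ... | yes e = let k , per , minimal = least em (λ k → fold x f (suc k) ≡ x) e in
    fin k (leastOf x) , fin-valid k x (exactPeriod-intro f k x per minimal) , leastOf-same x

  inf≁fin : ∀ u k c → Valid (inf u) → Valid (fin k c) → ¬ SameOrbit f (ρ u) c
  inf≁fin u k c Fu (per , _) u∼c =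
    aperiodic-same f-injective u∼c (τ.aperiodic u Fu) k (proj₁ (exactPeriod-elim f k c per))

  origin-separate : ∀ {i j} → Valid i → Valid j → SameOrbit f (origin i) (origin j) → i ≡ j
  origin-separate {inf u}   {inf v}   vi vj i∼j = cong inf (τ.separate vi vj i∼j)
  origin-separate {inf u}   {fin k c} vi vj i∼j = contradiction i∼j (inf≁fin u k c vi vj)
  origin-separate {fin k c} {inf v}   vi vj i∼j = contradiction (same-sym i∼j) (inf≁fin v k c vj vi)
  origin-separate {fin k c} {fin l d} (per , c-least) (per′ , d-least) i∼j
    with refl ← trans (sym c-least) (trans (leastOf-cong i∼j) d-least)
    with pk , mk ← exactPeriod-elim f k c per | pl , ml ← exactPeriod-elim f l c per′ =
    cong (λ k → fin k c) (≤-antisym (mk pl) (ml pk))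

  periods : ∀ {i} → Valid i → ∀ n →
    fold (origin i) f n ≡ origin i ⇔ fold (representative i) G n ≡ representative i
  periods {i} v zero = mk⇔ (λ _ → refl) (λ _ → refl)
  periods {inf u} Fu (suc n) =
    mk⇔ (λ per → contradiction per (τ.aperiodic u Fu n))
        (λ per → contradiction per (base-aperiodic u Fu n))
  periods {fin k c} (per , _) n@(suc _) =
    mk⇔ (λ eq → trans (cyc-run k c per n) (cong (cyc k) eq))
        (λ eq → cyc-injective (trans (sym (cyc-run k c per n)) eq))
    where
    cyc-injective : ∀ {k l y z} → cyc k y ≡ cyc l z → y ≡ z
    cyc-injective refl = refl

  ends : ∀ {i} → Valid i →
    (Backward f (origin i) × Backward G (representative i)) ⊎
    (Initial f (origin i) × Initial G (representative i))
  ends {inf u} Fu with N u in Nu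
  ... | true  = inj₁ (τ.backward u Nu , base-backward u Nu)
  ... | false = inj₂ (τ.initial u Fu Nu , base-initial u Fu Nu)
  ends {fin k c} (per , _) = inj₁
    ( periodic⇒backward f-injective k f-per
    , periodic⇒backward G-injective k (trans (cyc-run k c per (suc k)) (cong (cyc k) f-per)))
    where
    f-per = proj₁ (exactPeriod-elim f k c per)

  copy : ℕ → ℕ
  copy x = code (G (decode x))

  f≅copy : f ≅ copy
  f≅copy = record
    { bijection = Element↔ℕ ↔-∘ proj₁ iso
    ; commutes  = λ x → cong code (trans (proj₂ iso x)
                    (cong G (sym (decode-code (Inverse.to (proj₁ iso) x)))))
    }
    where
    iso : Σ[ θ ∈ ℕ ↔ Element ] ∀ x → Inverse.to θ (f x) ≡ G (Inverse.to θ x)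
    iso = isomorphism {Valid = Valid} {r = origin} {s = representative} record
      { f-injective = f-injective ; g-injective = G-injective
      ; f-cover     = origin-cover
      ; g-cover     = λ x → label x , label-valid x , cover x
      ; f-separate  = origin-separate
      ; g-separate  = separate
      ; periods     = periods
      ; ends        = ends
      }

-- Primitive recursiveness of the copy

module PrimitiveRecursiveCopy {O : Signature} (I : Oracle O)
  (f : ℕ → ℕ) (F N : ℕ → Bool) (u₀ : ℕ) (R : ℕ → ℕ → Bool) where
  open Closure I
  open Copy f F N u₀ R

  exactPeriod-Prim : Prim₁ f → Prim₂ λ k y → bit (exactPeriod f k y)
  exactPeriod-Prim pf = prim₂ (∧-Prim
    (compose₂ ≡ᵇ-Prim (compose₂ (fold-Prim pf) (compose₁ suc-Prim v₀) v₁) v₁)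
    (not-Prim (any-Prim {p = λ i xs → fold (x₁ xs) f (suc i) ≡ᵇ x₁ xs}
      (compose₂ ≡ᵇ-Prim (compose₂ (fold-Prim pf) (compose₁ suc-Prim v₀) v₂) v₂) v₀)))

  if-code-Prim : ∀ {n} {b : Vec ℕ n → Bool} {A B : Vec ℕ n → Element} →
    Prim (λ xs → bit (b xs)) → Prim (λ xs → code (A xs)) → Prim (λ xs → code (B xs)) →
    Prim λ xs → code (if b xs then A xs else B xs)
  if-code-Prim {b = b} pb pa pc =
    Prim-≗ (λ xs → sym (if-float code (b xs))) (if-Prim pb pa pc)

  main-Prim : Prim₁ λ m → code (main m)
  main-Prim = prim₁ (compose₂ pair-Prim (const-Prim 0) v₀)

  col-Prim : Prim₂ λ u v → code (col u v)
  col-Prim = prim₂ (compose₂ pair-Prim (const-Prim 1) (compose₂ pair-Prim v₀ v₁))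

  neg-Prim : Prim₂ λ u v → code (neg u v)
  neg-Prim = prim₂ (compose₂ pair-Prim (const-Prim 2) (compose₂ pair-Prim v₀ v₁))

  cyc-Prim : Prim₂ λ k y → code (cyc k y)
  cyc-Prim = prim₂ (compose₂ pair-Prim
    (compose₁ suc-Prim (compose₁ suc-Prim (compose₁ suc-Prim v₀))) v₁)

  after-Prim : ∀ {n} {C : Vec ℕ n → ℕ} → Prim C → Prim λ xs → code (main (suc (C xs)))
  after-Prim pa = compose₁ main-Prim (compose₁ suc-Prim pa)

  module _ (pf : Prim₁ f) (pF : Prim₁ λ u → bit (F u)) (pN : Prim₁ λ u → bit (N u))
           (pR : Prim₂ λ u v → bit (R u v)) where

    released-Prim : Prim₂ λ u v → bit (released u v)
    released-Prim = prim₂ (Prim-≗ (λ xs → sym (if-float bit (F (x₀ xs))))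
      (if-Prim (compose₁ pF v₀) (compose₂ ≡ᵇ-Prim v₀ (const-Prim u₀)) (compose₂ pR v₀ v₁)))

    -- Three nested case distinctions on the tag follow the clauses of `tagged`; in the last one the
    -- remaining argument is the `k` of `cyc k y`.
    last-Prim : Prim₂ λ t y → bit (last (tagged t y))
    last-Prim = prim₂ (Prim-case (const-Prim 0)
      (Prim-case (compose₂ released-Prim (compose₁ left-Prim v₀) (compose₁ right-Prim v₀))
      (Prim-case (not-Prim (compose₁ pN (compose₁ left-Prim v₀)))
      (not-Prim (compose₂ (exactPeriod-Prim pf) v₀ v₁)))))

    -- The position `v` comes first because `Prim-case` splits on the first argument.
    start-col-Prim : Prim₂ λ v u → code (start (col u v))
    start-col-Prim = prim₂ (Prim-case (compose₂ col-Prim v₀ (const-Prim 0))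
      (if-code-Prim (compose₂ released-Prim v₁ v₀)
        (compose₂ col-Prim v₁ (compose₁ suc-Prim v₀)) (compose₂ col-Prim v₁ (const-Prim 0))))

    start-Prim : Prim₂ λ t y → code (start (tagged t y))
    start-Prim = prim₂ (Prim-case (compose₁ main-Prim v₀)
      (Prim-case (compose₂ start-col-Prim (compose₁ right-Prim v₀) (compose₁ left-Prim v₀))
      (Prim-case (compose₂ neg-Prim (compose₁ left-Prim v₀) (compose₁ right-Prim v₀))
      (compose₂ cyc-Prim v₀ v₁))))

    above-Prim : Prim₂ λ v u → code (above u v)
    above-Prim = prim₂ (Prim-case
      (if-code-Prim (compose₂ ≡ᵇ-Prim v₀ (const-Prim u₀))
        (const-Prim (code (main 0))) (compose₂ col-Prim v₀ (const-Prim 0)))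
      (compose₂ neg-Prim v₁ v₀))

    G-Prim : Prim₂ λ t y → code (G (tagged t y))
    G-Prim = prim₂ (Prim-case
      (if-code-Prim (compose₂ last-Prim (compose₁ left-Prim v₀) (compose₁ right-Prim v₀))
        (compose₂ start-Prim (compose₁ left-Prim v₀) (compose₁ right-Prim v₀))
        (compose₁ main-Prim (compose₁ suc-Prim v₀)))
      (Prim-case
        (if-code-Prim (compose₂ released-Prim (compose₁ left-Prim v₀) (compose₁ right-Prim v₀))
          (after-Prim (compose₂ col-Prim (compose₁ left-Prim v₀) (compose₁ right-Prim v₀)))
          (compose₂ col-Prim (compose₁ left-Prim v₀) (compose₁ suc-Prim (compose₁ right-Prim v₀))))
      (Prim-case
        (if-code-Prim (compose₁ pN (compose₁ left-Prim v₀))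
          (compose₂ above-Prim (compose₁ right-Prim v₀) (compose₁ left-Prim v₀))
          (after-Prim (compose₂ neg-Prim (compose₁ left-Prim v₀) (compose₁ right-Prim v₀))))
        (if-code-Prim (compose₂ (exactPeriod-Prim pf) v₀ v₁)
          (compose₂ cyc-Prim v₀ (compose₁ pf v₁))
          (after-Prim (compose₂ cyc-Prim v₀ v₁))))))

    copy-Prim : Prim₁ λ x → code (G (decode x))
    copy-Prim = prim₁ (compose₂ G-Prim (compose₁ left-Prim v₀) (compose₁ right-Prim v₀))

-- Counting steps in the fast copy

module ImmediateRelease (f : ℕ → ℕ) (F N : ℕ → Bool) (u₀ : ℕ) where
  open Copy f F N u₀ (λ _ _ → true)

  -- The difference position - depth, an integer, increases along nonperiodic orbits.
  height : Element → ℕ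
  height (col u v) = v
  height _         = 0

  -- Doubling leaves one odd place between `main m` and `main (suc m)`, for the single element that
  -- may be inserted there.
  position : Element → ℕ
  position (main m) = m + m
  position x        = if last x then suc (code x + code x) else height x

  depth : Element → ℕ
  depth (neg u v) = if N u then suc v else 0
  depth _         = 0

  position-last : ∀ x → last x ≡ true → position x ≡ suc (code x + code x)
  position-last (col u v) l rewrite l = refl
  position-last (neg u v) l rewrite l = refl
  position-last (cyc k y) l rewrite l = refl

  depth-last : ∀ x → last x ≡ true → depth x ≡ 0
  depth-last (col u v) l = refl
  depth-last (neg u v) l with N u
  ... | false = refl
  depth-last (cyc k y) l = refl

  -- With immediate release every block has length one.
  start-last : ∀ x → last x ≡ true → start x ≡ x
  start-last (col u zero)    l = refl
  start-last (col u (suc v)) l rewrite l = refl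
  start-last (neg u v)       l = refl
  start-last (cyc k y)       l = refl

  position-after : ∀ x → last x ≡ true → position x + 0 < position (after x) + depth x
  position-after x l rewrite position-last x l | depth-last x l | +-suc (code x) (code x) = ≤-refl

  Nonperiodic : Element → Set
  Nonperiodic x = ∀ k y → x ≡ cyc k y → exactPeriod f k y ≡ false

  -- The strict increase of `position` minus `depth`, written without subtraction. Cycles are
  -- excluded, as both quantities are constant there.
  position-step : ∀ x → Nonperiodic x →
    position x + depth (G x) < position (G x) + depth x
  position-step (main m) _ with last (decode m) in l
  ... | true  rewrite start-last (decode m) l | position-last (decode m) l | depth-last (decode m) l
                    | code-decode m = ≤-refl
  ... | false rewrite +-suc m m = s≤s (m≤n⇒m≤1+n ≤-refl)
  position-step (col u v) _ with last (col u v) in l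
  ... | true  = subst (λ k → k + 0 < position (after (col u v)) + 0)
    (position-last (col u v) l) (position-after (col u v) l)
  ... | false rewrite l = ≤-refl
  position-step (neg u v) _ with N u in Nu
  position-step (neg u zero) _ | true with u ≡ᵇ u₀
  ... | true  = ≤-refl
  ... | false = m≤n+m 1 _
  position-step (neg u (suc v)) _ | true rewrite Nu = ≤-refl
  position-step (neg u v) _ | false with position-after (neg u v)
  ... | after-neg rewrite Nu = after-neg refl
  position-step (cyc k y) nonper with position-after (cyc k y)
  ... | after-cyc rewrite nonper k y refl = after-cyc refl

  position-bound : ∀ x → position x ≤ suc (code x + code x)
  position-bound (main m) = m≤n⇒m≤1+n (+-mono-≤ (right≤pair 0 m) (right≤pair 0 m))
  position-bound x@(col u v) with last x
  ... | true  = ≤-refl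
  ... | false = m≤n⇒m≤1+n (m≤n⇒m≤n+o (code x) (≤-trans (right≤pair u v) (right≤pair 1 (pair u v))))
  position-bound x@(neg u v) with last x
  ... | true  = ≤-refl
  ... | false = z≤n
  position-bound x@(cyc k y) with last x
  ... | true  = ≤-refl
  ... | false = z≤n

  -- Each step gains at least one, so after `n` steps the position is at least `n` minus the initial
  -- depth, while it is at most twice the code plus one.
  steps-bound : ∀ x → (∀ n → Nonperiodic (fold x G n)) → ∀ n →
    n ≤ suc (code (fold x G n) + code (fold x G n)) + depth x
  steps-bound x nonper n = ≤-trans (m+n≤o⇒m≤o n (m+n≤o⇒m≤o (n + position x) (potential n)))
    (+-monoˡ-≤ (depth x) (position-bound (fold x G n)))
    where
    open +-*-Solver
    potential : ∀ n → n + position x + depth (fold x G n) ≤ position (fold x G n) + depth x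
    potential zero    = ≤-refl
    -- Adding position and depth of the intermediate element `y` to both sides lets the two
    -- inequalities telescope in the natural numbers.
    potential (suc n) = +-cancelʳ-≤ (position y + depth y) _ _ (begin
      suc n + position x + depth (G y) + (position y + depth y)
        ≡⟨ solve 5 (λ n p d q e → con 1 :+ n :+ p :+ d :+ (q :+ e) := (n :+ p :+ e) :+ (con 1 :+ (q :+ d)))
             refl n (position x) (depth (G y)) (position y) (depth y) ⟩
      (n + position x + depth y) + suc (position y + depth (G y))
        ≤⟨ +-mono-≤ (potential n) (position-step y (nonper n)) ⟩
      (position y + depth x) + (position (G y) + depth y)
        ≡⟨ solve 4 (λ q d p e → (q :+ d) :+ (p :+ e) := p :+ d :+ (q :+ e))
             refl (position y) (depth x) (position (G y)) (depth y) ⟩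
      position (G y) + depth x + (position y + depth y)  ∎)
      where
      open ≤-Reasoning
      y = fold x G n

-- Evaluation with a bound on the searches

guard : ℕ → ℕ → ℕ
guard zero    y = 0
guard (suc _) y = y

guard-elim : ∀ x {y v} → guard x y ≡ suc v → (∃[ u ] x ≡ suc u) × y ≡ suc v
guard-elim (suc u) eq = (u , refl) , eq

-- `2 + k` keeps clear of the two codes for an unsuccessful search; `pred` sends these to divergence
-- and `2 + k` to the shifted result `k`.
test : ℕ → ℕ → ℕ
test 0             k = 1
test 1             k = 2 + k
test (suc (suc _)) k = 0

orElse : ℕ → ℕ → ℕ
orElse zero    y = y
orElse (suc x) y = suc x

-- Results are shifted by one: 0 stands for divergence.  For search e s k xs,
-- which explores the arguments below k, 0 means that all values are positive
-- and 1 that a divergent value comes before any zero.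
mutual

  run : ∀ {n} → Rec None n → ℕ → Vec ℕ n → ℕ
  run zero        s xs = 1
  run suc         s xs = suc (suc (head xs))
  run (proj i)    s xs = suc (lookup xs i)
  run (comp e ds) s xs = guard (converge ds s xs) (run e s (values ds s xs))
  run (rec d e)   s xs = recurse d e s (head xs) (tail xs)
  run (min e)     s xs = pred (search e s s xs)

  converge : ∀ {m n} → Vec (Rec None n) m → ℕ → Vec ℕ n → ℕ
  converge []       s xs = 1
  converge (d ∷ ds) s xs = guard (run d s xs) (converge ds s xs)

  values : ∀ {m n} → Vec (Rec None n) m → ℕ → Vec ℕ n → Vec ℕ m
  values []       s xs = []
  -- A divergent component gets the default value 0; `run` discards it by the guard `converge`.
  values (d ∷ ds) s xs = pred (run d s xs) ∷ values ds s xs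

  recurse : ∀ {n} → Rec None n → Rec None (2 + n) → ℕ → ℕ → Vec ℕ n → ℕ
  recurse d e s zero    xs = run d s xs
  recurse d e s (suc k) xs =
    guard (recurse d e s k xs) (run e s (k ∷ pred (recurse d e s k xs) ∷ xs))

  search : ∀ {n} → Rec None (suc n) → ℕ → ℕ → Vec ℕ n → ℕ
  search e s zero    xs = 0
  search e s (suc k) xs = orElse (search e s k xs) (test (run e s (k ∷ xs)) k)

search-+ : ∀ {n} (e : Rec None (suc n)) s k xs {v} → search e s k xs ≡ suc v →
  ∀ j → search e s (j + k) xs ≡ suc v
search-+ e s k xs eq zero = eq
search-+ e s k xs eq (suc j) rewrite search-+ e s k xs eq j = refl

mutual

  -- In the case of `min` the bound is used twice: `search-found` raises the bound on the inner
  -- evaluations, then `search-+` extends the range of the search.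
  run-mono : ∀ {n} (e : Rec None n) {s t} → s ≤ t → ∀ xs {v} →
    run e s xs ≡ suc v → run e t xs ≡ suc v
  run-mono zero        s≤t xs eq = eq
  run-mono suc         s≤t xs eq = eq
  run-mono (proj i)    s≤t xs eq = eq
  run-mono (comp e ds) {s} {t} s≤t xs eq with guard-elim (converge ds s xs) eq
  ... | (c , conv) , eq′ with converge-mono ds s≤t xs conv
  ...   | conv′ , vals rewrite conv′ | vals = run-mono e s≤t _ eq′
  run-mono (rec d e)   s≤t xs eq = recurse-mono d e s≤t (head xs) (tail xs) eq
  run-mono (min e) {s} {t} s≤t xs eq with search e s s xs in found
  run-mono (min e) {s} {t} s≤t xs refl | suc (suc v)
    with j , refl ← m≤n⇒∃[o]m+o≡n s≤t
    rewrite +-comm s j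
          | search-+ e (j + s) s xs (search-found e (m≤n+m s j) s xs found) j = refl

  converge-mono : ∀ {m n} (ds : Vec (Rec None n) m) {s t} → s ≤ t → ∀ xs {c} →
    converge ds s xs ≡ suc c → converge ds t xs ≡ suc c × values ds t xs ≡ values ds s xs
  converge-mono []       s≤t xs eq = eq , refl
  converge-mono (d ∷ ds) {s} s≤t xs eq with guard-elim (run d s xs) eq
  ... | (u , conv) , eq′ with converge-mono ds s≤t xs eq′
  ...   | conv′ , vals rewrite conv | run-mono d s≤t xs conv = conv′ , cong (u ∷_) vals

  recurse-mono : ∀ {n} (d : Rec None n) (e : Rec None (2 + n)) {s t} → s ≤ t → ∀ k xs {v} →
    recurse d e s k xs ≡ suc v → recurse d e t k xs ≡ suc v
  recurse-mono d e s≤t zero    xs eq = run-mono d s≤t xs eq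
  recurse-mono d e {s} s≤t (suc k) xs eq with guard-elim (recurse d e s k xs) eq
  ... | (u , conv) , eq′ rewrite conv | recurse-mono d e s≤t k xs conv = run-mono e s≤t _ eq′

  -- The code 1 is not stable, since a divergent value may converge under a larger bound. A zero
  -- that has been found and an initial segment of positive values are stable, and only these are
  -- preserved.
  search-found : ∀ {n} (e : Rec None (suc n)) {s t} → s ≤ t → ∀ k xs {v} →
    search e s k xs ≡ suc (suc v) → search e t k xs ≡ suc (suc v)
  search-found e {s} {t} s≤t (suc k) xs eq with search e s k xs in r
  ... | suc (suc _) rewrite search-found e s≤t k xs r = eq
  ... | zero rewrite search-continues e s≤t k xs r with run e s (k ∷ xs) in c
  ...   | suc zero rewrite run-mono e s≤t (k ∷ xs) c = eq

  search-continues : ∀ {n} (e : Rec None (suc n)) {s t} → s ≤ t → ∀ k xs →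
    search e s k xs ≡ 0 → search e t k xs ≡ 0
  search-continues e s≤t zero xs eq = refl
  search-continues e {s} s≤t (suc k) xs eq with search e s k xs in r
  ... | zero rewrite search-continues e s≤t k xs r with run e s (k ∷ xs) in c
  ...   | suc (suc _) rewrite run-mono e s≤t (k ∷ xs) c = refl

uniform-bound : ∀ {P : ℕ → ℕ → Set} → (∀ {z s t} → s ≤ t → P z s → P z t) →
  ∀ y → (∀ z → z < y → ∃[ s ] P z s) → ∃[ s ] ∀ z → z < y → P z s
uniform-bound mono zero    h = 0 , λ _ ()
uniform-bound {P} mono (suc y) h =
  let s , below = uniform-bound {P} mono y (λ z z<y → h z (m<n⇒m<1+n z<y))
      t , Pt    = h y ≤-refl
  in s ⊔ t , λ z z<1+y → case-≤ below Pt (m≤n⇒m<n∨m≡n (s≤s⁻¹ z<1+y))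
  where
  case-≤ : ∀ {s t z} → (∀ z → z < y → P z s) → P y t → z < y ⊎ z ≡ y → P z (s ⊔ t)
  case-≤ {s} {t} below Pt (inj₁ z<y)  = mono (m≤m⊔n s t) (below _ z<y)
  case-≤ {s} {t} below Pt (inj₂ refl) = mono (m≤n⊔m s t) Pt

search-none : ∀ {n} (e : Rec None (suc n)) s xs y →
  (∀ z → z < y → ∃[ v ] run e s (z ∷ xs) ≡ suc (suc v)) → search e s y xs ≡ 0
search-none e s xs zero    h = refl
search-none e s xs (suc y) h
  rewrite search-none e s xs y (λ z z<y → h z (m<n⇒m<1+n z<y)) | proj₂ (h y ≤-refl) = refl

mutual

  run-complete : ∀ {n} {e : Rec None n} {xs y} → _·_⇓_ none e xs y → ∃[ s ] run e s xs ≡ suc y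
  run-complete zero⇓ = 0 , refl
  run-complete suc⇓  = 0 , refl
  run-complete proj⇓ = 0 , refl
  run-complete (ask⇓ {o = ()})
  run-complete (comp⇓ {e = e} {ds} {xs} {z = z} ds⇓ e⇓) with runs-complete ds⇓ | run-complete e⇓
  ... | s , conv , vals | t , eq with converge-mono ds (m≤m⊔n s t) xs conv
  ...   | conv′ , vals′ = s ⊔ t , lemma
    where
    lemma : run (comp e ds) (s ⊔ t) xs ≡ suc z
    lemma rewrite conv′ | vals′ | vals = run-mono e (m≤n⊔m s t) _ eq
  run-complete (rec⇓₀ d⇓) = run-complete d⇓
  run-complete (rec⇓₊ {d = d} {e} {x} {xs} {z = z} rec⇓ e⇓) with run-complete rec⇓ | run-complete e⇓
  ... | s , eq | t , eq′ = s ⊔ t , lemma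
    where
    lemma : recurse d e (s ⊔ t) (suc x) xs ≡ suc z
    lemma rewrite recurse-mono d e (m≤m⊔n s t) x xs eq = run-mono e (m≤n⊔m s t) _ eq′
  run-complete (min⇓ {e = e} {xs} {y} e⇓₊ e⇓₀) with run-complete e⇓₀
    | uniform-bound {λ z s → ∃[ v ] run e s (z ∷ xs) ≡ suc (suc v)}
        (λ s≤t (v , eq) → v , run-mono e s≤t _ eq) y
        (λ z z<y → let s , eq = run-complete (proj₂ (e⇓₊ z z<y)) in s , _ , eq)
  ... | s , eq | t , below = r , cong pred (trans (cong (λ k → search e r k xs) (sym (m∸n+n≡m y<r)))
                                       (search-+ e r (suc y) xs found (r ∸ suc y)))
    where
    -- `r` is both bound and range: the range must contain `y`, `s` suffices for the zero at `y`,
    -- and `t` for the positive values before it.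
    r = suc y ⊔ (s ⊔ t)
    y<r : suc y ≤ r
    y<r = m≤m⊔n (suc y) (s ⊔ t)
    s≤r : s ≤ r
    s≤r = ≤-trans (m≤m⊔n s t) (m≤n⊔m (suc y) (s ⊔ t))
    t≤r : t ≤ r
    t≤r = ≤-trans (m≤n⊔m s t) (m≤n⊔m (suc y) (s ⊔ t))
    found : search e r (suc y) xs ≡ suc (suc y)
    found rewrite search-none e r xs y (λ z z<y → let v , eq = below z z<y in v , run-mono e t≤r _ eq)
                | run-mono e s≤r (y ∷ xs) eq = refl

  runs-complete : ∀ {m n} {ds : Vec (Rec None n) m} {xs ys} → _·_⇓*_ none ds xs ys →
    ∃[ s ] converge ds s xs ≡ 1 × values ds s xs ≡ ys
  runs-complete [] = 0 , refl , refl
  runs-complete (_∷_ {e = d} {ds} {xs} {y} {ys} d⇓ ds⇓) with run-complete d⇓ | runs-complete ds⇓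
  ... | s , eq | t , conv , vals with converge-mono ds (m≤n⊔m s t) xs conv
  ...   | conv′ , vals′ = s ⊔ t , conv″ , vals″
    where
    conv″ : converge (d ∷ ds) (s ⊔ t) xs ≡ 1
    conv″ rewrite run-mono d (m≤m⊔n s t) xs eq = conv′
    vals″ : values (d ∷ ds) (s ⊔ t) xs ≡ y ∷ ys
    vals″ rewrite run-mono d (m≤m⊔n s t) xs eq = cong (y ∷_) (trans vals′ vals)

run-sound : ∀ {n} {e : Rec None n} {xs y} → _·_⇓_ none e xs y → ∀ {s v} → run e s xs ≡ suc v → v ≡ y
run-sound {e = e} {xs} e⇓ {s} eq = let t , eq′ = run-complete e⇓ in suc-injective
  (trans (sym (run-mono e (m≤m⊔n s t) xs eq)) (run-mono e (m≤n⊔m s t) xs eq′))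

-- Primitive recursiveness of the bounded evaluation

module _ {O : Signature} (I : Oracle O) where
  open Closure I

  guard-Prim : Prim₂ guard
  guard-Prim = prim₂ (Prim-case (const-Prim 0) v₁)

  orElse-Prim : Prim₂ orElse
  orElse-Prim = prim₂ (Prim-case v₀ (compose₁ suc-Prim v₀))

  test-Prim : Prim₂ test
  test-Prim = prim₂ (Prim-case (const-Prim 1)
    (Prim-case (compose₁ suc-Prim (compose₁ suc-Prim v₀)) (const-Prim 0)))

  lookup-Prim : ∀ {n} i → Prim {n} λ xs → lookup xs i
  lookup-Prim i = proj i , λ _ → refl

  tail³-Prim : ∀ {n} → PrimVec {n} λ xs → tail (tail (tail xs))
  tail³-Prim = substituteVec-Prim tail-Prim (substituteVec-Prim tail-Prim tail-Prim)

  mutual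

    run-Prim : ∀ {n} (e : Rec None n) → Prim λ xs → run e (x₀ xs) (tail xs)
    run-Prim zero        = const-Prim 1
    run-Prim suc         = compose₁ suc-Prim (compose₁ suc-Prim v₁)
    run-Prim (proj i)    = compose₁ suc-Prim (substitute-Prim (lookup-Prim i) tail-Prim)
    run-Prim (comp e ds) = compose₂ guard-Prim (converge-Prim ds)
      (substitute-Prim (run-Prim e) (v₀ ∷-Prim values-Prim ds))
    run-Prim (rec d e)   = substitute-Prim (recurse-Prim d e)
      (v₁ ∷-Prim v₀ ∷-Prim substituteVec-Prim tail-Prim tail-Prim)
    run-Prim (min e)     = compose₁ pred-Prim (substitute-Prim (search-Prim e) (v₀ ∷-Prim id-Prim))

    converge-Prim : ∀ {m n} (ds : Vec (Rec None n) m) → Prim λ xs → converge ds (x₀ xs) (tail xs)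
    converge-Prim []       = const-Prim 1
    converge-Prim (d ∷ ds) = compose₂ guard-Prim (run-Prim d) (converge-Prim ds)

    values-Prim : ∀ {m n} (ds : Vec (Rec None n) m) → PrimVec λ xs → values ds (x₀ xs) (tail xs)
    values-Prim []       = []-Prim
    values-Prim (d ∷ ds) = compose₁ pred-Prim (run-Prim d) ∷-Prim values-Prim ds

    recurse-Prim : ∀ {n} (d : Rec None n) (e : Rec None (2 + n)) →
      Prim λ xs → recurse d e (x₁ xs) (x₀ xs) (tail (tail xs))
    recurse-Prim d e = Prim-rec (run-Prim d)
      (compose₂ guard-Prim v₁ (substitute-Prim (run-Prim e)
        (v₂ ∷-Prim v₀ ∷-Prim compose₁ pred-Prim v₁ ∷-Prim tail³-Prim)))
      λ _ _ → refl

    search-Prim : ∀ {n} (e : Rec None (suc n)) →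
      Prim λ xs → search e (x₁ xs) (x₀ xs) (tail (tail xs))
    search-Prim e = Prim-rec (const-Prim 0)
      (compose₂ orElse-Prim v₁ (compose₂ test-Prim
        (substitute-Prim (run-Prim e) (v₂ ∷-Prim v₀ ∷-Prim tail³-Prim)) v₀))
      λ _ _ → refl

-- Enumeration of the infinite orbits

-- Only `present` must be primitive recursive, because the copies are built from it alone; `element`
-- may be any function. Thus the number of elements of `W` is all the information that is used
-- effectively.
record Enumeration (W : ℕ → Set) : Set where
  field
    present      : ℕ → Bool
    present-Prim : Closure.Prim₁ none λ i → bit (present i)
    element      : ℕ → ℕ
    member       : ∀ {i} → present i ≡ true → W (element i)
    injective    : ∀ {i j} → present i ≡ true → present j ≡ true → element i ≡ element j → i ≡ j
    surjective   : ∀ {x} → W x → ∃[ i ] present i ≡ true × element i ≡ x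

module Counting (em : ExcludedMiddle 0ℓ) (W : ℕ → Set) where
  open Closure none

  count : ℕ → ℕ
  count zero    = 0
  count (suc x) with em {W x}
  ... | yes _ = suc (count x)
  ... | no  _ = count x

  count-≤-suc : ∀ x → count x ≤ count (suc x)
  count-≤-suc x with em {W x}
  ... | yes _ = n≤1+n _
  ... | no  _ = ≤-refl

  count-mono : ∀ {x y} → x ≤ y → count x ≤ count y
  count-mono {x} {y} x≤y with m≤n⇒m<n∨m≡n x≤y
  ... | inj₂ refl = ≤-refl
  count-mono {x} {suc y} x≤y | inj₁ x<1+y = ≤-trans (count-mono (s≤s⁻¹ x<1+y)) (count-≤-suc y)

  count-suc : ∀ {x} → W x → count (suc x) ≡ suc (count x)
  count-suc {x} Wx with em {W x}
  ... | yes _  = refl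
  ... | no ¬Wx = contradiction Wx ¬Wx

  count-< : ∀ {x y} → W x → x < y → count x < count y
  count-< Wx x<y = ≤-trans (≤-reflexive (sym (count-suc Wx))) (count-mono x<y)

  count-injective : ∀ {x y} → W x → W y → count x ≡ count y → x ≡ y
  count-injective Wx Wy eq = ≤-antisym
    (≮⇒≥ λ y<x → <-irrefl (sym eq) (count-< Wy y<x))
    (≮⇒≥ λ x<y → <-irrefl eq (count-< Wx x<y))

  Attained : ℕ → Set
  Attained i = ∃[ x ] W x × count x ≡ i

  attained-below : ∀ x {i} → i < count x → Attained i
  attained-below (suc x) i<c with em {W x}
  ... | no _ = attained-below x i<c
  ... | yes Wx with m≤n⇒m<n∨m≡n (s≤s⁻¹ i<c)
  ...   | inj₁ i<c′ = attained-below x i<c′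
  ...   | inj₂ refl = x , Wx , refl

  -- The default 0 is never read, as `element i` matters only when `i` is present.
  pick : ∀ {i} → Dec (Attained i) → ℕ
  pick (yes (x , _)) = x
  pick (no _)        = 0

  pick-attained : ∀ {i} (d : Dec (Attained i)) → Attained i → W (pick d) × count (pick d) ≡ i
  pick-attained (yes (_ , Wx , eq)) _ = Wx , eq
  pick-attained (no ∄)              a = contradiction a ∄

  enumerate : (b : ℕ → Bool) → Prim₁ (λ i → bit (b i)) →
    (∀ {i} → b i ≡ true → Attained i) → (∀ {i} → Attained i → b i ≡ true) → Enumeration W
  enumerate b b-Prim sound complete = record
    { present      = b
    ; present-Prim = b-Prim
    ; element      = λ i → pick {i} em
    ; member       = λ bi → proj₁ (pick-attained em (sound bi))
    ; injective    = λ bi bj eq → trans (sym (proj₂ (pick-attained em (sound bi))))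
                       (trans (cong count eq) (proj₂ (pick-attained em (sound bj))))
    ; surjective   = λ {x} Wx → let W-pick , eq = pick-attained em (x , Wx , refl) in
                       count x , complete (x , Wx , refl) , count-injective W-pick Wx eq
    }

  -- The attained values of count form an initial segment of ℕ, which is
  -- primitive recursive because it is either ℕ or bounded by a constant.
  enumeration : Enumeration W
  enumeration with em {∃[ n ] ¬ Attained n}
  ... | no ∄ = enumerate (λ _ → true) (prim₁ (const-Prim 1))
    (λ {i} _ → decidable-stable em λ ¬a → ∄ (i , ¬a)) (λ _ → refl)
  ... | yes e with n , ¬a , minimal ← least em (λ n → ¬ Attained n) e =
    enumerate (λ i → i <ᵇ n) (prim₁ (compose₂ <ᵇ-Prim v₀ (const-Prim n)))
      (λ {i} i<n → decidable-stable em λ ¬ai → <-irrefl refl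
        (<-≤-trans (<ᵇ⇒< i n (Equivalence.from T-≡ i<n)) (minimal ¬ai)))
      (λ {i} ai → Equivalence.to T-≡ (<⇒<ᵇ (≰⇒> (beyond ai))))
    where
    beyond : ∀ {i} → Attained i → ¬ n ≤ i
    beyond a@(x , _ , refl) n≤i with m≤n⇒m<n∨m≡n n≤i
    ... | inj₁ n<i  = ¬a (attained-below x n<i)
    ... | inj₂ refl = ¬a a

module InfiniteOrbits (em : ExcludedMiddle 0ℓ) (f : ℕ → ℕ) (f-injective : Injective _≡_ _≡_ f) where
  open Closure none

  -- An ω-chain has a distinguished element, its first one; for a ζ-chain the numerically least
  -- element takes this role.
  Least : ℕ → Set
  Least x = Aperiodic f x × Backward f x × (∀ {y} → SameOrbit f x y → x ≤ y)

  module ω = Enumeration (Counting.enumeration em (Initial f))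
  module ζ = Enumeration (Counting.enumeration em Least)

  -- The family 0 consists of the ω-chains, the family 1 of the ζ-chains.
  infinite twoSided : ℕ → ℕ → Bool
  infinite 0             i = ω.present i
  infinite 1             i = ζ.present i
  infinite (suc (suc _)) i = false
  twoSided 0             i = false
  twoSided 1             i = ζ.present i
  twoSided (suc (suc _)) i = false

  root : ℕ → ℕ → ℕ
  root 0             i = ω.element i
  root 1             i = ζ.element i
  root (suc (suc _)) i = 0

  F N : ℕ → Bool
  F u = infinite (left u) (right u)
  N u = twoSided (left u) (right u)

  ρ : ℕ → ℕ
  ρ u = root (left u) (right u)

  F-Prim : Prim₁ λ u → bit (F u)
  F-Prim = prim₁ (compose₂ infinite-Prim (compose₁ left-Prim v₀) (compose₁ right-Prim v₀))
    where
    infinite-Prim : Prim₂ λ t i → bit (infinite t i)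
    infinite-Prim = prim₂ (Prim-case (compose₁ ω.present-Prim v₀)
      (Prim-case (compose₁ ζ.present-Prim v₀) (const-Prim 0)))

  N-Prim : Prim₁ λ u → bit (N u)
  N-Prim = prim₁ (compose₂ twoSided-Prim (compose₁ left-Prim v₀) (compose₁ right-Prim v₀))
    where
    twoSided-Prim : Prim₂ λ t i → bit (twoSided t i)
    twoSided-Prim = prim₂ (Prim-case (const-Prim 0)
      (Prim-case (compose₁ ζ.present-Prim v₀) (const-Prim 0)))

  least-same : ∀ {x y} → Least x → Least y → SameOrbit f x y → x ≡ y
  least-same (_ , _ , x≤) (_ , _ , y≤) x∼y = ≤-antisym (x≤ x∼y) (y≤ (same-sym x∼y))

  initial-same : ∀ {x y} → Initial f x → Initial f y → SameOrbit f x y → x ≡ y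
  initial-same {x} {y} init init′ (m , n , eq) with <-cmp m n
  ... | tri< m<n _ _ = let k , m+k≡n = m≤n⇒∃[o]m+o≡n m<n in
    contradiction (sym (fold-+-cancel f-injective m
      (trans eq (cong (fold y f) (trans (sym m+k≡n) (sym (+-suc m k))))))) (init _)
  ... | tri≈ _ refl _ = fold-injective f-injective m eq
  ... | tri> _ _ n<m = let k , n+k≡m = m≤n⇒∃[o]m+o≡n n<m in
    contradiction (sym (fold-+-cancel f-injective n
      (trans (sym eq) (cong (fold x f) (trans (sym n+k≡m) (sym (+-suc n k))))))) (init′ _)

  initial-not-backward : ∀ {x} → Initial f x → ¬ Backward f x
  initial-not-backward init back = let y , eq = back 1 in init y eq

  root-separate : ∀ t {i} t′ {j} → infinite t i ≡ true → infinite t′ j ≡ true →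
    SameOrbit f (root t i) (root t′ j) → t ≡ t′ × i ≡ j
  root-separate 0 0 p q same = refl , ω.injective p q (initial-same (ω.member p) (ω.member q) same)
  root-separate 1 1 p q same = refl , ζ.injective p q (least-same (ζ.member p) (ζ.member q) same)
  root-separate 0 1 p q same = contradiction
    (backward-same f-injective (same-sym same) (proj₁ (proj₂ (ζ.member q))))
    (initial-not-backward (ω.member p))
  root-separate 1 0 p q same = contradiction
    (backward-same f-injective same (proj₁ (proj₂ (ζ.member p))))
    (initial-not-backward (ω.member q))

  root-aperiodic : ∀ t i → infinite t i ≡ true → Aperiodic f (root t i)
  root-aperiodic 0 i p = initial⇒aperiodic (ω.member p)
  root-aperiodic 1 i p = proj₁ (ζ.member p)

  root-backward : ∀ t i → twoSided t i ≡ true → Backward f (root t i)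
  root-backward 1 i p = proj₁ (proj₂ (ζ.member p))

  root-initial : ∀ t i → infinite t i ≡ true → twoSided t i ≡ false → Initial f (root t i)
  root-initial 0 i p q = ω.member p
  root-initial 1 i p q = true≢false p q

  twoSided⇒infinite : ∀ t i → twoSided t i ≡ true → infinite t i ≡ true
  twoSided⇒infinite 1 i p = p

  root-cover : ∀ y → Aperiodic f y → ∃[ t ] ∃[ i ] infinite t i ≡ true × SameOrbit f y (root t i)
  root-cover y ap with em {∃[ n ] ¬ (∃[ x ] fold x f n ≡ y)}
  ... | no ∄ =
    let z , y∼z , minimal = least em (SameOrbit f y) (y , same-refl)
        back              = λ n → decidable-stable em λ ¬x → ∄ (n , ¬x)
        i , p , eq        = ζ.surjective
          ( aperiodic-same f-injective y∼z ap
          , backward-same f-injective y∼z back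
          , λ z∼w → minimal (same-trans y∼z z∼w))
    in 1 , i , p , subst (SameOrbit f y) (sym eq) y∼z
  -- Let `suc n` be least such that `y` has no preimage under that many steps (0 is excluded by `y`
  -- itself); then the preimage of `y` under `n` steps is initial.
  ... | yes e with least em (λ n → ¬ (∃[ x ] fold x f n ≡ y)) e
  ...   | zero  , ¬x , _       = contradiction (y , refl) ¬x
  ...   | suc n , ¬x , minimal =
    let x , x↦y    = decidable-stable em λ ¬x → <-irrefl refl (minimal {n} ¬x)
        i , p , eq = ω.surjective {x} λ z fz≡x →
          ¬x (z , trans (sym (fold-comm f z 1 n)) (trans (cong (λ x → fold x f n) fz≡x) x↦y))
    in 0 , i , p , 0 , n , trans (sym x↦y) (cong (λ x → fold x f n) (sym eq))

  transversal : Transversal f F N ρ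
  transversal = record
    { N⇒F       = λ u → twoSided⇒infinite (left u) (right u)
    ; aperiodic = λ u → root-aperiodic (left u) (right u)
    ; backward  = λ u → root-backward (left u) (right u)
    ; initial   = λ u → root-initial (left u) (right u)
    ; separate  = λ {u} {v} p q u∼v →
        let l , r = root-separate (left u) (left v) p q u∼v in
        trans (sym (pair-left-right u)) (trans (cong₂ pair l r) (pair-left-right v))
    ; cover     = λ y ap → let t , i , p , same = root-cover y ap in
        pair t i ,
        subst₂ (λ t i → infinite t i ≡ true) (sym (left-pair t i)) (sym (right-pair t i)) p ,
        subst₂ (λ t i → SameOrbit f y (root t i)) (sym (left-pair t i)) (sym (right-pair t i)) same
    }

-- If `a` returns after `k + 1` steps, its first `k + 1` iterates exhaust the orbit. An element that
-- reaches `a` in `n` steps is an iterate too: `a` also returns to itself after `n + m` steps for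
-- some `m`, and `n` steps can be cancelled.
infinite⇒aperiodic : ∀ {f} → Injective _≡_ _≡_ f → ∀ {a} → ¬ FiniteOrbit f a → Aperiodic f a
infinite⇒aperiodic {f} f-injective {a} ∞ k per = ∞ (applyUpTo (fold a f) (suc k) , λ where
    b (n , inj₁ eq) → listed n eq
    b (n , inj₂ eq) → let m , eq′ = returns n in
      listed m (sym (fold-+-cancel f-injective n (trans eq (sym eq′)))))
  where
  reduce : ∀ n → ∃[ i ] i ≤ k × fold a f n ≡ fold a f i
  reduce zero = 0 , z≤n , refl
  reduce (suc n) with reduce n
  ... | i , i≤k , eq with m≤n⇒m<n∨m≡n i≤k
  ...   | inj₁ i<k  = suc i , i<k , cong f eq
  ...   | inj₂ refl = 0 , z≤n , trans (cong f eq) per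
  listed : ∀ n {b} → fold a f n ≡ b → Any (_≡ b) (applyUpTo (fold a f) (suc k))
  listed n eq = let i , i≤k , eq′ = reduce n in
    applyUpTo⁺ (fold a f) (trans (sym eq′) eq) (s≤s i≤k)
  returns : ∀ n → ∃[ m ] fold a f (n + m) ≡ a
  returns zero    = 0 , refl
  returns (suc n) = let m , eq = returns n in k + m , (begin
    fold a f (suc n + (k + m))       ≡⟨ cong (fold a f ∘ suc) (x∙yz≈y∙xz n k m) ⟩
    fold a f (suc k + (n + m))       ≡⟨ fold-+ a f (suc k) ⟩
    fold (fold a f (n + m)) f (suc k) ≡⟨ cong (λ x → fold x f (suc k)) eq ⟩
    fold a f (suc k)                 ≡⟨ per ⟩
    a                                ∎)
    where open ≡-Reasoning

-- Elimination of computable oracles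

mutual

  embed : ∀ {n} → PR None n → Rec None n
  embed zero        = zero
  embed suc         = suc
  embed (proj i)    = proj i
  embed (ask ())
  embed (comp p ps) = comp (embed p) (embeds ps)
  embed (rec p q)   = rec (embed p) (embed q)

  embeds : ∀ {m n} → Vec (PR None n) m → Vec (Rec None n) m
  embeds []       = []
  embeds (p ∷ ps) = embed p ∷ embeds ps

mutual

  embed-⇓ : ∀ {n} (p : PR None n) xs → _·_⇓_ none (embed p) xs (eval none p xs)
  embed-⇓ zero        []           = zero⇓
  embed-⇓ suc         (x ∷ [])     = suc⇓
  embed-⇓ (proj i)    xs           = proj⇓
  embed-⇓ (comp p ps) xs           = comp⇓ (embeds-⇓ ps xs) (embed-⇓ p _)
  embed-⇓ (rec p q)   (zero  ∷ xs) = rec⇓₀ (embed-⇓ p xs)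
  embed-⇓ (rec p q)   (suc x ∷ xs) = rec⇓₊ (embed-⇓ (rec p q) (x ∷ xs)) (embed-⇓ q _)

  embeds-⇓ : ∀ {m n} (ps : Vec (PR None n) m) xs → _·_⇓*_ none (embeds ps) xs (evals none ps xs)
  embeds-⇓ []       xs = []
  embeds-⇓ (p ∷ ps) xs = embed-⇓ p xs ∷ embeds-⇓ ps xs

Prim⇒Computable : ∀ {n} {D : Vec ℕ n → ℕ} → Closure.Prim none D → Computable none D
Prim⇒Computable (p , p≗) = embed p , λ xs → subst (_·_⇓_ none (embed p) xs) (p≗ xs) (embed-⇓ p xs)

module _ {k : ℕ} (q : Rec None k) where

  mutual

    compile : ∀ {n} → Rec (Single k) n → Rec None n
    compile zero        = zero
    compile suc         = suc
    compile (proj i)    = proj i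
    compile (ask the)   = q
    compile (comp e es) = comp (compile e) (compiles es)
    compile (rec d e)   = rec (compile d) (compile e)
    compile (min e)     = min (compile e)

    compiles : ∀ {m n} → Vec (Rec (Single k) n) m → Vec (Rec None n) m
    compiles []       = []
    compiles (e ∷ es) = compile e ∷ compiles es

  module _ {D : Vec ℕ k → ℕ} (q⇓ : ∀ xs → _·_⇓_ none q xs (D xs)) where

    mutual

      compile-⇓ : ∀ {n} {e : Rec (Single k) n} {xs y} →
        _·_⇓_ (single D) e xs y → _·_⇓_ none (compile e) xs y
      compile-⇓ zero⇓                = zero⇓
      compile-⇓ suc⇓                 = suc⇓
      compile-⇓ proj⇓                = proj⇓
      compile-⇓ (ask⇓ {o = the})     = q⇓ _
      compile-⇓ (comp⇓ es⇓ e⇓)       = comp⇓ (compiles-⇓ es⇓) (compile-⇓ e⇓)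
      compile-⇓ (rec⇓₀ d⇓)           = rec⇓₀ (compile-⇓ d⇓)
      compile-⇓ (rec⇓₊ r⇓ e⇓)        = rec⇓₊ (compile-⇓ r⇓) (compile-⇓ e⇓)
      compile-⇓ (min⇓ e⇓₊ e⇓₀)       =
        min⇓ (λ z z<y → let v , e⇓ = e⇓₊ z z<y in v , compile-⇓ e⇓) (compile-⇓ e⇓₀)

      compiles-⇓ : ∀ {m n} {es : Vec (Rec (Single k) n) m} {xs ys} →
        _·_⇓*_ (single D) es xs ys → _·_⇓*_ none (compiles es) xs ys
      compiles-⇓ []         = []
      compiles-⇓ (e⇓ ∷ es⇓) = compile-⇓ e⇓ ∷ compiles-⇓ es⇓

Σ⁰₁-computable-oracle : ∀ {k n} {D : Vec ℕ k → ℕ} {P : Pred (Vec ℕ n) 0ℓ} →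
  Computable none D → Σ⁰₁ (single D) P → Σ⁰₁ none P
Σ⁰₁-computable-oracle (q , q⇓) (R , (e , e⇓) , P⇔) =
  R , (compile q e , λ xs → compile-⇓ q q⇓ (e⇓ xs)) , P⇔

-- The inclusion of the cone in the spectrum

Σ⁰₁-transpose : ∀ {P Q : Pred (Vec ℕ 2) 0ℓ} → (∀ x y → Q (y ∷ x ∷ []) ⇔ P (x ∷ y ∷ [])) →
  Σ⁰₁ none P → Σ⁰₁ none Q
Σ⁰₁-transpose Q⇔P (R , (e , e⇓) , P⇔) =
  (λ xs → R (transpose xs)) ,
  (comp e (proj zero ∷ proj (suc (suc zero)) ∷ proj (suc zero) ∷ []) ,
   λ { (z ∷ y ∷ x ∷ []) → comp⇓ (proj⇓ ∷ proj⇓ ∷ proj⇓ ∷ []) (e⇓ (z ∷ x ∷ y ∷ [])) }) ,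
  λ { (y ∷ x ∷ []) → P⇔ (x ∷ y ∷ []) ⇔-∘ Q⇔P x y }
  where
  transpose : Vec ℕ 3 → Vec ℕ 3
  transpose (z ∷ y ∷ x ∷ []) = z ∷ x ∷ y ∷ []

Δ⁰₁-inverse : ∀ {f g} (θ : f ≅ g) → Δ⁰₁Function none (to θ) → Δ⁰₁Function none (from θ)
Δ⁰₁-inverse θ (σ , π) =
  Σ⁰₁-transpose (λ x y → mk⇔ (graph x y) (cograph x y)) σ ,
  Σ⁰₁-transpose (λ x y → mk⇔ (_∘ cograph x y) (_∘ graph x y)) π
  where
  graph : ∀ x y → from θ y ≡ x → to θ x ≡ y
  graph x y eq = trans (cong (to θ) (sym eq)) (Inverse.strictlyInverseˡ (_≅_.bijection θ) y)
  cograph : ∀ x y → to θ x ≡ y → from θ y ≡ x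
  cograph x y eq = trans (cong (from θ) (sym eq)) (Inverse.strictlyInverseʳ (_≅_.bijection θ) x)

module _ where
  open Closure none

  atomicDiagram-Prim : ∀ {g} → Prim₁ g → Prim (atomicDiagram g)
  atomicDiagram-Prim {g} pg = Prim-≗ (λ { (n ∷ a ∷ m ∷ b ∷ []) → refl })
    (compose₂ ≡ᵇ-Prim (compose₂ (fold-Prim pg) v₀ v₁)
      (compose₂ (fold-Prim pg) v₂ (substitute-Prim v₂ tail-Prim)))

Cone⊆Spec : ∀ {f} → RelativelyΔ⁰₁Categorical f → ConeΔ⁰₁ ⊆ PRCatSpec f
Cone⊆Spec categorical d∈Cone g g-pr f≅g =
  let θ , σ , π = categorical g f≅g
      diagram   = Prim⇒Computable (atomicDiagram-Prim (Closure.Prim-unary none g-pr))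
      θ∈Δ       = Σ⁰₁-computable-oracle diagram σ , Σ⁰₁-computable-oracle diagram π
  in θ , d∈Cone (to θ) θ∈Δ , d∈Cone (from θ) (Δ⁰₁-inverse θ θ∈Δ)

-- Bounding the search for the values of a Δ⁰₁ function

module Δ⁰₁Search {h : ℕ → ℕ} {R : Vec ℕ 3 → Bool} {e : Rec None 3}
  (e⇓ : ∀ xs → _·_⇓_ none e xs (χ R xs))
  (h⇔ : ∀ xs → Graph h xs ⇔ (∃[ z ] χ R (z ∷ xs) ≡ 1)) where

  value : ℕ → ℕ
  value w = right (right w)

  -- `w` codes a bound on the evaluation, a Σ⁰₁ witness and a candidate for the value of `h n`; 2 is
  -- the truth value 1 in shifted form.
  check : ℕ → ℕ → Bool
  check n w = run e (left w) (left (right w) ∷ n ∷ value w ∷ []) ≡ᵇ 2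

  check-sound : ∀ n w → check n w ≡ true → value w ≡ h n
  check-sound n w eq = sym (Equivalence.from (h⇔ (n ∷ value w ∷ []))
    (left (right w) , sym (run-sound (e⇓ _) (≡ᵇ-true⇒≡ eq))))

  check-complete : ∀ n → ∃[ w ] check n w ≡ true
  check-complete n =
    let z , χ≡1 = Equivalence.to (h⇔ (n ∷ h n ∷ [])) refl
        s , eq  = run-complete (e⇓ (z ∷ n ∷ h n ∷ []))
    in pair s (pair z (h n)) , lemma s z (trans eq (cong suc χ≡1))
    where
    lemma : ∀ s z → run e s (z ∷ n ∷ h n ∷ []) ≡ 2 → check n (pair s (pair z (h n))) ≡ true
    lemma s z eq rewrite left-pair s (pair z (h n)) | right-pair s (pair z (h n))
                       | left-pair z (h n) | right-pair z (h n) = ≡⇒≡ᵇ-true eq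

  found : ℕ → ℕ → Bool
  found n s = any< (check n) s

  found-total : ∀ n → ∃[ s ] found n s ≡ true
  found-total n = let w , eq = check-complete n in suc w , any<-intro (check n) ≤-refl eq

  found-mono : ∀ n {s t} → s ≤ t → found n s ≡ true → found n t ≡ true
  found-mono n {s} s≤t eq = let w , w<s , eq′ = any<-elim (check n) s eq in
    any<-intro (check n) (<-≤-trans w<s s≤t) eq′

  -- The largest successful `w` below the bound is taken; by `check-sound` all of them carry the
  -- same value.
  result : ℕ → ℕ → ℕ
  result n zero    = 0
  result n (suc w) = if check n w then value w else result n w

  result-found : ∀ n s → found n s ≡ true → result n s ≡ h n
  result-found n (suc w) eq with check n w in c
  ... | true  = check-sound n w c
  ... | false = result-found n w eq

  module _ {O : Signature} (I : Oracle O) where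
    open Closure I

    value-Prim : Prim₁ value
    value-Prim = prim₁ (compose₁ right-Prim (compose₁ right-Prim v₀))

    check-Prim : Prim₂ λ w n → bit (check n w)
    check-Prim = prim₂ (compose₂ ≡ᵇ-Prim
      (substitute-Prim (run-Prim I e)
        (compose₁ left-Prim v₀ ∷-Prim compose₁ left-Prim (compose₁ right-Prim v₀)
         ∷-Prim v₁ ∷-Prim compose₁ value-Prim v₀ ∷-Prim []-Prim))
      (const-Prim 2))

    found-Prim : Prim₂ λ n s → bit (found n s)
    found-Prim = prim₂ (any-Prim {p = λ w xs → check (x₀ xs) w} (compose₂ check-Prim v₀ v₁) v₁)

    result-Prim : Prim₂ λ s n → result n s
    result-Prim = prim₂ (Prim-rec (const-Prim 0)
      (if-Prim (compose₂ check-Prim v₀ v₂) (compose₁ value-Prim v₀) v₁) λ _ _ → refl)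

-- Comparison of the slow and the fast copy

intertwine-fold : ∀ {A B : Set} {f : A → A} {g : B → B} (ψ : A → B) → (∀ x → ψ (f x) ≡ g (ψ x)) →
  ∀ n x → ψ (fold x f n) ≡ fold (ψ x) g n
intertwine-fold ψ comm zero    x = refl
intertwine-fold {g = g} ψ comm (suc n) x = trans (comm _) (cong g (intertwine-fold ψ comm n x))

module _ {f g : ℕ → ℕ} (θ : f ≅ g) where
  open Inverse (_≅_.bijection θ) using (strictlyInverseˡ; strictlyInverseʳ)

  to-injective : ∀ {x y} → to θ x ≡ to θ y → x ≡ y
  to-injective eq = trans (sym (strictlyInverseʳ _)) (trans (cong (from θ) eq) (strictlyInverseʳ _))

  from-injective : ∀ {x y} → from θ x ≡ from θ y → x ≡ y
  from-injective eq = trans (sym (strictlyInverseˡ _)) (trans (cong (to θ) eq) (strictlyInverseˡ _))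

  from-commutes : ∀ y → from θ (g y) ≡ f (from θ y)
  from-commutes y = to-injective (begin
    to θ (from θ (g y))  ≡⟨ strictlyInverseˡ (g y) ⟩
    g y                  ≡⟨ cong g (strictlyInverseˡ y) ⟨
    g (to θ (from θ y))  ≡⟨ _≅_.commutes θ (from θ y) ⟨
    to θ (f (from θ y))  ∎)
    where open ≡-Reasoning

module Comparison (em : ExcludedMiddle 0ℓ) (f : ℕ → ℕ) (f-injective : Injective _≡_ _≡_ f)
  (a : ℕ) (a-aperiodic : Aperiodic f a) (found : ℕ → ℕ → Bool)
  (found-mono : ∀ n {s t} → s ≤ t → found n s ≡ true → found n t ≡ true)
  (found-total : ∀ n → ∃[ s ] found n s ≡ true) where

  open InfiniteOrbits em f f-injective

  special : ∃[ u ] F u ≡ true × SameOrbit f a (ρ u)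
  special = Transversal.cover transversal a a-aperiodic

  u₀ : ℕ
  u₀ = proj₁ special

  F-u₀ : F u₀ ≡ true
  F-u₀ = proj₁ (proj₂ special)

  -- Defined on all `u`: every column without an infinite orbit waits for some search, and totality
  -- of `found` ends each wait.
  delay : ℕ → ℕ → Bool
  delay u v = found (right u) v

  module Fast = CopyIsomorphism em f F N u₀ (λ _ _ → true) ρ f-injective F-u₀ transversal
    (λ _ _ _ → refl) (λ _ → 0 , refl)
  module Slow = CopyIsomorphism em f F N u₀ delay ρ f-injective F-u₀ transversal
    (λ u v → found-mono (right u) (n≤1+n v)) (λ u → found-total (right u))
  open ImmediateRelease f F N u₀ using (steps-bound; depth)

  -- Families 0 and 1 belong to the ω-chains and the ζ-chains; family 2 contains no infinite orbit,
  -- so its columns are free for coding.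
  column : ℕ → ℕ
  column n = pair 2 n

  released-column : ∀ n v → Slow.released (column n) v ≡ found n v
  released-column n v = trans
    (cong (λ t → if infinite t (right (column n)) then column n ≡ᵇ u₀
                 else found (right (column n)) v) (left-pair 2 n))
    (cong (λ n → found n v) (right-pair 2 n))

  module _ (ψ : ℕ → ℕ) (ψ-commutes : ∀ x → ψ (Slow.copy x) ≡ Fast.copy (ψ x))
           (ψ-injective : ∀ {x y} → ψ x ≡ ψ y → x ≡ y) where

    image : Element → Element
    image x = decode (ψ (code x))

    image-commutes : ∀ x → image (Slow.G x) ≡ Fast.G (image x)
    image-commutes x = begin
      decode (ψ (code (Slow.G x)))                  ≡⟨ cong (λ y → decode (ψ (code (Slow.G y)))) (decode-code x) ⟨
      decode (ψ (Slow.copy (code x)))               ≡⟨ cong decode (ψ-commutes (code x)) ⟩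
      decode (code (Fast.G (decode (ψ (code x)))))  ≡⟨ decode-code (Fast.G (image x)) ⟩
      Fast.G (image x)                              ∎
      where open ≡-Reasoning

    image-injective : ∀ {x y} → image x ≡ image y → x ≡ y
    image-injective {x} {y} eq = begin
      x                ≡⟨ decode-code x ⟨
      decode (code x)  ≡⟨ cong decode (ψ-injective ψ-eq) ⟩
      decode (code y)  ≡⟨ decode-code y ⟩
      y                ∎
      where
      open ≡-Reasoning
      ψ-eq : ψ (code x) ≡ ψ (code y)
      ψ-eq = trans (sym (code-decode (ψ (code x)))) (trans (cong code eq) (code-decode (ψ (code y))))

    b : Element
    b = image (main 0)

    image-fold : ∀ k → image (fold (main 0) Slow.G k) ≡ fold b Fast.G k
    image-fold k = intertwine-fold {f = Slow.G} {Fast.G} image image-commutes k (main 0)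

    b-aperiodic : Aperiodic Fast.G b
    b-aperiodic k per = Slow.base-aperiodic u₀ F-u₀ k
      (subst (λ x → fold x Slow.G (suc k) ≡ x) (sym Slow.base-u₀)
        (image-injective (trans (image-fold (suc k)) per)))

    entryImage : ℕ → ℕ
    entryImage n = ψ (code (col (column n) 0))

    -- The right-hand side of `steps-bound` for a run from `b` to the image of the head of the
    -- column.
    time : ℕ → ℕ
    time n = suc (entryImage n + entryImage n) + depth b

    -- With `v` the first released position and `k` the distance of the head from `main 0`, `entry`
    -- gives `v ≤ k` in the slow copy. The isomorphism preserves `k`, and `steps-bound` in the fast
    -- copy gives `k ≤ time n`.
    found-by-time : ∀ n → found n (time n) ≡ true
    found-by-time n =
      let s , eq        = found-total n
          v , r , first = least em (λ v → Slow.released (column n) v ≡ true)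
                            (s , trans (released-column n s) eq)
          k , v≤k , run = Slow.entry (column n) v r (λ w r → first r)
      in found-mono n (≤-trans v≤k (k≤time k run)) (trans (sym (released-column n v)) r)
      where
      k≤time : ∀ k → fold (main 0) Slow.G k ≡ col (column n) 0 → k ≤ time n
      k≤time k run = subst (λ c → k ≤ suc (c + c) + depth b) code-run
        (steps-bound b (Fast.aperiodic⇒nonperiodic b-aperiodic) k)
        where
        code-run : code (fold b Fast.G k) ≡ entryImage n
        code-run = begin
          code (fold b Fast.G k)                 ≡⟨ cong code (image-fold k) ⟨
          code (image (fold (main 0) Slow.G k))  ≡⟨ cong (code ∘ image) run ⟩
          code (decode (entryImage n))           ≡⟨ code-decode (entryImage n) ⟩
          entryImage n                           ∎
          where open ≡-Reasoning

Δ⁰₁-≤PR : ExcludedMiddle 0ℓ → ∀ {f} → Closure.Prim₁ none f → Injective _≡_ _≡_ f →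
  ∀ {a} → Aperiodic f a → ∀ {d} → PRCatSpec f d → ∀ {h} → Σ⁰₁ none (Graph h) → h ≤PR d
Δ⁰₁-≤PR em {f} f-Prim f-injective {a} a-aperiodic {d} d∈Spec {h} (R , (e , e⇓) , h⇔) =
  D.unary-Prim (D.prim₁ (D.Prim-≗ (λ xs → t-correct (x₀ xs))
    (D.compose₂ (result-Prim (single (unary d))) (D.compose₁ time-Prim D.v₀) D.v₀)))
  where
  open Δ⁰₁Search {h} {R} {e} e⇓ h⇔
  open Comparison em f f-injective a a-aperiodic found found-mono found-total
  open InfiniteOrbits em f f-injective using (F; N; F-Prim; N-Prim)
  open Closure none
  module D = Closure (single (unary d))

  fast-Prim : Prim₁ Fast.copy
  fast-Prim = PrimitiveRecursiveCopy.copy-Prim none f F N u₀ (λ _ _ → true)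
    f-Prim F-Prim N-Prim (prim₂ (const-Prim 1))

  slow-Prim : Prim₁ Slow.copy
  slow-Prim = PrimitiveRecursiveCopy.copy-Prim none f F N u₀ delay
    f-Prim F-Prim N-Prim (prim₂ (compose₂ (found-Prim none) (compose₁ right-Prim v₀) v₁))

  fast : Σ[ θ ∈ f ≅ Fast.copy ] (to θ ≤PR d × from θ ≤PR d)
  fast = d∈Spec Fast.copy (unary-Prim fast-Prim) Fast.f≅copy

  slow : Σ[ θ ∈ f ≅ Slow.copy ] (to θ ≤PR d × from θ ≤PR d)
  slow = d∈Spec Slow.copy (unary-Prim slow-Prim) Slow.f≅copy

  -- The spectrum compares `f` with its copies, not the copies with each other, so the isomorphism
  -- between them passes through `f`.
  ψ : ℕ → ℕ
  ψ x = to (proj₁ fast) (from (proj₁ slow) x)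

  ψ-commutes : ∀ x → ψ (Slow.copy x) ≡ Fast.copy (ψ x)
  ψ-commutes x = trans (cong (to (proj₁ fast)) (from-commutes (proj₁ slow) x))
                       (_≅_.commutes (proj₁ fast) (from (proj₁ slow) x))

  ψ-injective : ∀ {x y} → ψ x ≡ ψ y → x ≡ y
  ψ-injective eq = from-injective (proj₁ slow) (to-injective (proj₁ fast) eq)

  t : ℕ → ℕ
  t = time ψ ψ-commutes ψ-injective

  t-correct : ∀ n → result n (t n) ≡ h n
  t-correct n = result-found n (t n) (found-by-time ψ ψ-commutes ψ-injective n)

  ψ-Prim : D.Prim₁ ψ
  ψ-Prim = D.prim₁ (D.compose₁ (D.Prim-unary (proj₁ (proj₂ fast)))
    (D.compose₁ (D.Prim-unary (proj₂ (proj₂ slow))) D.v₀))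

  entry-Prim : D.Prim₁ λ n → ψ (code (col (column n) 0))
  entry-Prim = D.prim₁ (D.compose₁ ψ-Prim
    (D.compose₂ (PrimitiveRecursiveCopy.col-Prim (single (unary d)) f F N u₀ delay)
      (D.compose₂ D.pair-Prim (D.const-Prim 2) D.v₀) (D.const-Prim 0)))

  time-Prim : D.Prim₁ t
  time-Prim = D.prim₁ (D.compose₂ D.+-Prim
    (D.compose₁ D.suc-Prim
      (D.compose₂ D.+-Prim (D.compose₁ entry-Prim D.v₀) (D.compose₁ entry-Prim D.v₀)))
    -- The depth of `b` does not depend on the argument and enters as a constant.
    (D.const-Prim _))

theorem2p2 : ExcludedMiddle 0ℓ →
    (f : ℕ → ℕ) → PrimitiveRecursive f → Injective _≡_ _≡_ f →
    RelativelyΔ⁰₁Categorical f →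
    HasInfiniteOrbit f → InfinitelyManyFiniteOrbits f →
    PRCatSpec f ≐ ConeΔ⁰₁
theorem2p2 em f f-pr f-injective categorical (a , a-infinite) _ =
  (λ d∈Spec h (σ , _) → Δ⁰₁-≤PR em (Closure.Prim-unary none f-pr) f-injective
     (infinite⇒aperiodic f-injective a-infinite) d∈Spec σ) ,
  Cone⊆Spec categorical
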